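{- Let $R$ be a $\mathbb{Q}$-vector space and $Z \colon \mathcal{I} \rightarrow R$ a $\mathbb{Q}$-linear map satisfying the Ohno-type relation. Extend $Z$ to the $\mathbb{Q}[t]$-linear map $Z \colon \mathcal{I}^t \rightarrow R\otimes\mathbb{Q}[t]$ and set $Z^t \coloneqq Z\circ I^t$. Then, for any admissible index $\boldsymbol{k}$ and any non-negative integer $m$, \begin{align*} Z^{t}\bigl(g_m(\boldsymbol{k};t)\bigr) =\sum_{\substack{\mathrm{wt} (\boldsymbol{e})=m \\ \mathrm{dep} (\boldsymbol{e})=\mathrm{dep} (\boldsymbol{k}^{\dagger})}} Z^{t}\bigl((\boldsymbol{k}^{\dagger}\oplus\boldsymbol{e})^{\dagger}\bigr), \end{align*} where $\boldsymbol{e}$ runs over tuples of non-negative integers.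
   Context: For a tuple of non-negative integers $\boldsymbol{e}=(e_1,\dots,e_r)$, $\mathrm{wt}(\boldsymbol{e})=e_1+\cdots+e_r$ and $\mathrm{dep}(\boldsymbol{e})=r$. An index is a tuple of positive integers (the empty index $\varnothing$ has depth 0); an index $(k_1,\dots,k_r)$ is admissible if $r\ge1$ and $k_r\ge2$, or it is $\varnothing$. For $\boldsymbol{k}=(k_1,\dots,k_r)$ and $\boldsymbol{e}=(e_1,\dots,e_r)$, $\boldsymbol{k}\oplus\boldsymbol{e}=(k_1+e_1,\dots,k_r+e_r)$ and $\varnothing\oplus\varnothing=\varnothing$. For an admissible index written as $\boldsymbol{k}=(\{1\}^{a_1-1}, b_1+1, \ldots, \{1\}^{a_s-1}, b_s+1)$ with $a_p,b_q\ge1$, the dual index is $\boldsymbol{k}^{\dagger}=(\{1\}^{b_s-1}, a_s+1, \ldots, \{1\}^{b_1-1}, a_1+1)$, and $\varnothing^\dagger=\varnothing$. $\mathcal{I}$ (resp. $\mathcal{I}^t$) is the set of formal $\mathbb{Q}$-linear (resp. $\mathbb{Q}[t]$-linear) sums of indices. A $\mathbb{Q}$-linear map $Z\colon\mathcal{I}\to R$ satisfies the Ohno-type relation if for every admissible index $\boldsymbol{k}$ and every $m\ge0$, $\sum_{\mathrm{wt}(\boldsymbol{e})=m,\ \mathrm{dep}(\boldsymbol{e})=\mathrm{dep}(\boldsymbol{k})} Z(\boldsymbol{k}\oplus\boldsymbol{e}) = \sum_{\mathrm{wt}(\boldsymbol{e})=m,\ \mathrm{dep}(\boldsymbol{e})=\mathrm{dep}(\boldsymbol{k}^\dagger)}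 Z((\boldsymbol{k}^\dagger\oplus\boldsymbol{e})^\dagger)$. $I^t\colon\mathcal{I}^t\to\mathcal{I}^t$ is the $\mathbb{Q}[t]$-linear map with $I^t(\varnothing)=\varnothing$ and $I^t(k_1,\dots,k_r)=\sum t^{(\text{number of `+'})}(k_1\square k_2\square\cdots\square k_r)$, summing over all choices of each $\square$ as a comma or a plus. For integers $k\ge1$, $i,e\ge0$, $f_i(k,e)=\sum_{j=0}^{e}\binom{e-j}{i}\binom{k+e-i-2}{j}t^j(1-t)^{e-i-j}\in\mathbb{Q}[t]$, and $f_i(k,-1)=0$. For a non-empty index $\boldsymbol{k}=(k_1,\dots,k_r)$ and $m\ge0$, with $k'_j=k_j+\delta_{j,1}$, $g_m(\boldsymbol{k};t)=\sum_{l=1}^{r}(-t(1-t))^{r-l}\sum_{\boldsymbol{e}=(e_1,\dots,e_l)\in\mathbb{Z}_{\ge0}^l,\ e_1+\cdots+e_l=m}\ \sum_{1=i_1<\cdots<i_{l+1}=r+1}\prod_{l'=1}^{l}f_{i_{l'+1}-i_{l'}-1}(k'_{i_{l'}}+\cdots+k'_{i_{l'+1}-1},e_{l'})\times\bigl((k_{i_1}+\cdots+k_{i_2-1},\dots,k_{i_l}+\cdots+k_{i_{l+1}-1})\oplus\boldsymbol{e}\bigr)\in\mathcal{I}^t$; also $g_{ -1}(\boldsymbol{k};t)=0$ and $g_m(\varnothing;t)=\delta_{m,0}\cdot\varnothing$. -}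

module Defs where

open import Level using (Level)
open import Data.Nat using (ℕ; zero; suc; _+_; _∸_; _≤_)
open import Data.Nat.Combinatorics using (_C_)
open import Data.Integer using (+_)
open import Data.Rational using (ℚ; 0ℚ; 1ℚ; -_) renaming (_+_ to _+ℚ_; _*_ to _*ℚ_)
open import Data.Rational using (_/_)
open import Data.Rational.Properties using (+-*-commutativeRing)
open import Data.List using (List; []; _∷_; _++_; map; concatMap; foldr; length; replicate; reverse; zipWith; upTo)
open import Data.Nat.ListAction using (sum)
open import Data.List.Relation.Unary.All using (All)
open import Data.Product using (_×_; _,_; swap)
open import Data.Unit using (⊤)
open import Data.Bool using (Bool; true; false)
open import Algebra.Module.Bundles using (Module)

-- Indices: lists of natural numbers (the theorem only uses lists of
-- positive integers).

Index : Set
Index = List ℕ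

-- k ⊕ e (componentwise sum; used only for equal depths)
_⊕_ : Index → List ℕ → Index
_⊕_ = zipWith _+_

LastGe2 : Index → Set
LastGe2 []           = ⊤
LastGe2 (x ∷ [])     = 2 ≤ x
LastGe2 (x ∷ y ∷ ys) = LastGe2 (y ∷ ys)

Admissible : Index → Set
Admissible k = All (1 ≤_) k × LastGe2 k

comps : ℕ → ℕ → List (List ℕ)
comps zero zero       = [] ∷ []
comps zero (suc m)    = []
comps (suc r) m       = concatMap (λ j → map (j ∷_) (comps r (m ∸ j))) (upTo (suc m))

-- Duality.  parse k c writes ({1}^{a1-1}, b1+1, …) as [(a1,b1), …];
-- c counts the 1's read so far in the current block.

parse : Index → ℕ → List (ℕ × ℕ)
parse []                  c = []
parse (zero ∷ xs)         c = parse xs (suc c)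
parse (suc zero ∷ xs)     c = parse xs (suc c)
parse (suc (suc y) ∷ xs)  c = (suc c , suc y) ∷ parse xs 0

build : List (ℕ × ℕ) → Index
build []             = []
build ((a , b) ∷ ps) = replicate (a ∸ 1) 1 ++ (suc b ∷ build ps)

-- (a1,b1),…,(as,bs) ↦ ({1}^{bs-1}, as+1, …, {1}^{b1-1}, a1+1)
dual : Index → Index
dual k = build (map swap (reverse (parse k 0)))

-- I^t on a single index: list of (power of t, index)

It-go : ℕ → List ℕ → List (ℕ × Index)
It-go acc []       = (0 , acc ∷ []) ∷ []
It-go acc (y ∷ ys) =
  map (λ { (p , z) → (p , acc ∷ z) }) (It-go y ys)
  ++ map (λ { (p , z) → (suc p , z) }) (It-go (acc + y) ys)

It : Index → List (ℕ × Index)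
It []       = (0 , []) ∷ []
It (x ∷ xs) = It-go x xs

-- Polynomials in ℚ[t] as coefficient lists (constant term first).

Poly : Set
Poly = List ℚ

ℕ→ℚ : ℕ → ℚ
ℕ→ℚ n = + n / 1

padd : Poly → Poly → Poly
padd []       q        = q
padd (a ∷ p)  []       = a ∷ p
padd (a ∷ p)  (b ∷ q)  = (a +ℚ b) ∷ padd p q

pscale : ℚ → Poly → Poly
pscale a = map (a *ℚ_)

pmul : Poly → Poly → Poly
pmul []      q = []
pmul (a ∷ p) q = padd (pscale a q) (0ℚ ∷ pmul p q)

pone : Poly
pone = 1ℚ ∷ []

ppow : Poly → ℕ → Poly
ppow p zero    = pone
ppow p (suc n) = pmul p (ppow p n)

tpow : ℕ → Poly
tpow j = replicate j 0ℚ ++ (1ℚ ∷ [])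

oneMinusT : Poly
oneMinusT = 1ℚ ∷ (- 1ℚ) ∷ []

minusTOneMinusT : Poly
minusTOneMinusT = 0ℚ ∷ (- 1ℚ) ∷ 1ℚ ∷ []

coeff : Poly → ℕ → ℚ
coeff []      n       = 0ℚ
coeff (a ∷ p) zero    = a
coeff (a ∷ p) (suc n) = coeff p n

psum : List Poly → Poly
psum = foldr padd []

-- f_i(k,e) = Σ_{j=0}^{e} C(e-j,i) C(k+e-i-2,j) t^j (1-t)^{e-i-j}
-- (for k ≥ 1, i, e ≥ 0; truncated subtraction)

f : ℕ → ℕ → ℕ → Poly
f i k e = psum (map (λ j →
    pscale (ℕ→ℚ ((e ∸ j) C i) *ℚ ℕ→ℚ (((k + e) ∸ (i + 2)) C j))
           (pmul (tpow j) (ppow oneMinusT ((e ∸ i) ∸ j))))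
  (upTo (suc e)))

LinComb : Set
LinComb = List (Poly × Index)

-- decompositions of a list into consecutive non-empty blocks
-- (equivalently choices 1 = i_1 < … < i_{l+1} = r+1)
blocks-go : ℕ → List ℕ → List (List (List ℕ))
blocks-go x []       = ((x ∷ []) ∷ []) ∷ []
blocks-go x (y ∷ ys) =
  map (λ { [] → [] ; (b ∷ bs) → (x ∷ b) ∷ bs }) (blocks-go y ys)
  ++ map ((x ∷ []) ∷_) (blocks-go y ys)

blocks : List ℕ → List (List (List ℕ))
blocks []       = [] ∷ []
blocks (x ∷ xs) = blocks-go x xs

-- Π_{l'} f_{|B_{l'}|-1}(k'-sum of B_{l'}, e_{l'}); the Bool marks the
-- first block, where k'_1 = k_1 + 1.
prodF : Bool → List (List ℕ) → List ℕ → Poly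
prodF first (b ∷ bs) (e ∷ es) =
  pmul (f (length b ∸ 1) (sum b + (if first then 1 else 0)) e) (prodF false bs es)
  where open import Data.Bool using (if_then_else_)
prodF first _ _ = pone

g : ℕ → Index → LinComb
g zero    []       = (pone , []) ∷ []
g (suc m) []       = []
g m       (x ∷ xs) =
  concatMap (λ bs →
    map (λ e →
      ( pmul (ppow minusTOneMinusT (length (x ∷ xs) ∸ length bs)) (prodF true bs e)
      , (map sum bs ⊕ e)))
      (comps (length bs) m))
    (blocks (x ∷ xs))

-- Z, its ℚ[t]-linear extension and Z^t = Z ∘ I^t, with values in
-- R ⊗ ℚ[t] ≅ R[t], an element of which is given by its coefficient
-- sequence ℕ → R (coefficient of t^n).

module _ {c ℓ : Level} (R : Module +-*-commutativeRing c ℓ) where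
  open Module R

  sumᴹ : List Carrierᴹ → Carrierᴹ
  sumᴹ = foldr _+ᴹ_ 0ᴹ

  Zext : (Index → Carrierᴹ) → LinComb → ℕ → Carrierᴹ
  Zext Z xs n = sumᴹ (map (λ { (p , k) → coeff p n *ₗ Z k }) xs)

  Itlin : LinComb → LinComb
  Itlin = concatMap (λ { (p , k) → map (λ { (j , k') → (pmul p (tpow j) , k') }) (It k) })

  Zt : (Index → Carrierᴹ) → LinComb → ℕ → Carrierᴹ
  Zt Z xs = Zext Z (Itlin xs)

  -- the Ohno-type relation for the ℚ-linear map Z : 𝓘 → R, given by
  -- its values on the basis of indices
  OhnoType : (Index → Carrierᴹ) → Set ℓ
  OhnoType Z = (k : Index) → Admissible k → (m : ℕ) →
    sumᴹ (map (λ e → Z (k ⊕ e)) (comps (length k) m))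
      ≈ᴹ sumᴹ (map (λ e → Z (dual (dual k ⊕ e))) (comps (length (dual k)) m))

{-# OPTIONS --safe #-}

-- Write an index as the word y x^(k₁-1) ⋯ y x^(kᵣ-1) in two non-commuting letters and let λ record the
-- weight added.  Every construction is then a substitution of power series for the letters:
--   σ : x ↦ x,                y ↦ y + t x                                  (Iᵗ, away from the first y)
--   P : x ↦ x,                y ↦ y (1 - λx)⁻¹                             (k ↦ k ⊕ e)
--   Q : x ↦ (1 - λy)⁻¹ x,     y ↦ y                                        (k ↦ (k† ⊕ e)†)
--   θ : x ↦ x (1 - λtx)⁻¹,    y ↦ y (1 - λtx)(1 - λx)⁻¹ - t(1-t)λx²(1 - λx)⁻¹   (k ↦ Σ λᵐ gₘ(k;t))
-- where the leading y is fixed by σ and goes to y (1 - λx)⁻¹ under θ; the formula for θ holds because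
-- Σₑ fᵢ(k,e) zᵉ = zⁱ (1 - z)^(-i-1) (1 - tz)^(i+2-k).  With
--   C : x ↦ x (1 - λtx)⁻¹,    y ↦ y (1 - λtx) + t x
-- one finds σ ∘ θ = P ∘ C and σ ∘ Q = Q ∘ C on letters, so that the two sides of the theorem are the two
-- sides of the Ohno-type relation for the image under C of the word of k, a combination of admissible words.
-- Dually, words act by multiplication on functions of words, and the substitutions become compositions of
-- operators on such functions.
module Submission where

open import Defs
open import Level using (Level; _⊔_)
open import Data.Nat using (ℕ; zero; suc; _+_; _∸_; _≤_; _<_; z≤n; s≤s)
import Data.Nat.Properties as ℕ
open import Data.Nat.Combinatorics using (_C_; nCk+nC[k+1]≡[n+1]C[k+1]; k>n⇒nCk≡0)
open import Data.Nat.ListAction using (sum)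
open import Data.Nat.Tactic.RingSolver using (solve-∀)
open import Data.Bool using (true; false)
import Data.Integer as ℤ
import Data.Integer.Properties as ℤ
open import Data.Integer using (+_)
open import Data.List using (List; []; _∷_; _++_; map; concatMap; applyUpTo; upTo; length; reverse; replicate)
open import Data.List.Properties using (map-++; map-cong; unfold-reverse; ++-assoc; ++-identityʳ)
open import Data.List.Relation.Unary.All as All using (All; []; _∷_)
open import Data.List.Relation.Unary.All.Properties using (map⁺; ++⁺)
open import Data.Product using (_×_; _,_; proj₁; proj₂; ∃; ∃₂; swap)
open import Data.Rational using (ℚ; 0ℚ; 1ℚ; toℚᵘ) renaming (_+_ to _+ℚ_; _*_ to _*ℚ_; -_ to -ℚ_)
import Data.Rational.Properties as ℚ
open import Data.Rational.Properties using (+-*-commutativeRing)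
import Data.Rational.Unnormalised as ℚᵘ
import Data.Rational.Unnormalised.Properties as ℚᵘ
open import Data.Sum using (inj₁; inj₂)
open import Function using (_∘′_)
open import Algebra.Bundles using (AbelianGroup)
open import Algebra.Module.Bundles using (Module)
import Algebra.Construct.Pointwise as Pointwise
import Algebra.Properties.AbelianGroup as AbelianGroupProperties
import Algebra.Properties.CommutativeSemigroup as CommutativeSemigroupProperties
open import Relation.Binary.PropositionalEquality as ≡ using (_≡_)
import Relation.Binary.Reasoning.Setoid as SetoidReasoning

-- Words and duality

data Letter : Set where
  x y : Letter

Word : Set
Word = List Letter

Positive : Index → Set
Positive = All (1 ≤_)

pow : Letter → ℕ → Word → Word
pow a zero    w = w
pow a (suc n) w = pow a n (a ∷ w)

pow-∷ : ∀ a n w → pow a n (a ∷ w) ≡ a ∷ pow a n w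
pow-∷ a zero    w = ≡.refl
pow-∷ a (suc n) w = pow-∷ a n (a ∷ w)

pow-+ : ∀ a m n w → pow a (m + n) w ≡ pow a m (pow a n w)
pow-+ a zero    n w = ≡.refl
pow-+ a (suc m) n w = ≡.trans (pow-+ a m n (a ∷ w)) (≡.cong (pow a m) (pow-∷ a n w))

-- Words are stored last letter first and without the leading y of the word of an index, so that
-- appending a letter is _∷_ and Iᵗ acts on all letters uniformly.
push : Index → Word → Word
push []       u = u
push (k ∷ ks) u = push ks (pow x (k ∸ 1) (y ∷ u))

word : Index → Word
word []       = []
word (k ∷ ks) = push ks (pow x (k ∸ 1) [])

-- The accumulators are the number of x's read since the last y and the parts already completed.
unword : Word → ℕ → Index → Index
unword []      a ks = suc a ∷ ks
unword (x ∷ r) a ks = unword r (suc a) ks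
unword (y ∷ r) a ks = unword r 0 (suc a ∷ ks)

index : Word → Index
index r = unword r 0 []

unword-pow : ∀ a r b ks → unword (pow x a r) b ks ≡ unword r (a + b) ks
unword-pow zero    r b ks = ≡.refl
unword-pow (suc a) r b ks = unword-pow a (x ∷ r) b ks

unword-push : ∀ ks → Positive ks → ∀ u → unword (push ks u) 0 [] ≡ unword u 0 ks
unword-push []       []                u = ≡.refl
unword-push (suc k ∷ ks) (s≤s z≤n ∷ p) u =
  ≡.trans (unword-push ks p (pow x k (y ∷ u))) (≡.trans (unword-pow k (y ∷ u) 0 ks) (≡.cong (λ c → unword u 0 (suc c ∷ ks)) (ℕ.+-identityʳ k)))

index-push : ∀ a ks → Positive ks → index (push ks (pow x a [])) ≡ suc a ∷ ks
index-push a ks p = ≡.trans (unword-push ks p (pow x a [])) (≡.trans (unword-pow a [] 0 ks) (≡.cong (λ c → suc c ∷ ks) (ℕ.+-identityʳ a)))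

word-unword : ∀ r a ks → word (unword r a ks) ≡ push ks (pow x a r)
word-unword []      a ks = ≡.refl
word-unword (x ∷ r) a ks = word-unword r (suc a) ks
word-unword (y ∷ r) a ks = word-unword r 0 (suc a ∷ ks)

word-index : ∀ r → word (index r) ≡ r
word-index r = word-unword r 0 []

unword-positive : ∀ r a ks → Positive ks → Positive (unword r a ks)
unword-positive []      a ks p = s≤s z≤n ∷ p
unword-positive (x ∷ r) a ks p = unword-positive r (suc a) ks p
unword-positive (y ∷ r) a ks p = unword-positive r 0 (suc a ∷ ks) (s≤s z≤n ∷ p)

unword-lastGe2 : ∀ r a k ks → LastGe2 (k ∷ ks) → LastGe2 (unword r a (k ∷ ks))
unword-lastGe2 []      a k ks p = p
unword-lastGe2 (x ∷ r) a k ks p = unword-lastGe2 r (suc a) k ks p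
unword-lastGe2 (y ∷ r) a k ks p = unword-lastGe2 r 0 (suc a) (k ∷ ks) p

unword-suc-lastGe2 : ∀ r a → LastGe2 (unword r (suc a) [])
unword-suc-lastGe2 []      a = s≤s (s≤s z≤n)
unword-suc-lastGe2 (x ∷ r) a = unword-suc-lastGe2 r (suc a)
unword-suc-lastGe2 (y ∷ r) a = unword-lastGe2 r 0 (suc (suc a)) [] (s≤s (s≤s z≤n))

-- The head `x` is the last letter of the word, so it raises the last part to at least 2.
index-admissible : ∀ r → Admissible (index (x ∷ r))
index-admissible r = unword-positive r 1 [] [] , unword-suc-lastGe2 r 0

unword-∷ : ∀ r a ks → ∃₂ λ k ks′ → unword r a ks ≡ k ∷ ks′
unword-∷ []      a ks = suc a , ks , ≡.refl
unword-∷ (x ∷ r) a ks = unword-∷ r (suc a) ks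
unword-∷ (y ∷ r) a ks = unword-∷ r 0 (suc a ∷ ks)

-- If k ∷ ks has word y w x, then core k ks is w, read forwards and with x and y exchanged.
core : ℕ → Index → Word
core k []        = pow y (k ∸ 2) []
core k (k₂ ∷ ks) = pow y (k ∸ 1) (x ∷ core k₂ ks)

-- The way back from `core` to a stored word: the word is reversed, the two letters are exchanged
-- again, and the final x is restored on top.
flip : Word → Word → Word
flip []      u = x ∷ u
flip (x ∷ s) u = flip s (y ∷ u)
flip (y ∷ s) u = flip s (x ∷ u)

flip-∷ : ∀ s u → ∃ λ r → flip s u ≡ x ∷ r
flip-∷ []      u = u , ≡.refl
flip-∷ (x ∷ s) u = flip-∷ s (y ∷ u)
flip-∷ (y ∷ s) u = flip-∷ s (x ∷ u)

flip-pow : ∀ n s u → flip (pow y n s) u ≡ flip s (pow x n u)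
flip-pow zero    s u = ≡.refl
flip-pow (suc n) s u = ≡.trans (flip-pow n (y ∷ s) u) (≡.cong (flip s) (≡.sym (pow-∷ x n u)))

push-flip : ∀ k ks → Admissible (k ∷ ks) → ∀ u → push ks (pow x (k ∸ 1) u) ≡ flip (core k ks) u
push-flip (suc (suc k)) [] (_ , s≤s (s≤s z≤n)) u =
  ≡.trans (pow-∷ x k u) (≡.sym (flip-pow k [] u))
push-flip (suc zero) [] (_ , s≤s ())
push-flip k (k₂ ∷ ks) (p ∷ ps , l) u =
  ≡.trans (push-flip k₂ ks (ps , l) (y ∷ pow x (k ∸ 1) u)) (≡.sym (flip-pow (k ∸ 1) (x ∷ core k₂ ks) u))

word-flip : ∀ k ks → Admissible (k ∷ ks) → word (k ∷ ks) ≡ flip (core k ks) []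
word-flip k ks p = push-flip k ks p []

-- By dual-index, swapped k is the stored word of the dual of k.
swapped : Index → Word
swapped []       = []
swapped (k ∷ ks) = x ∷ core k ks

swapped-unword : ∀ r a k ks → swapped (unword r a (k ∷ ks)) ≡ flip r (pow y a (x ∷ core k ks))
swapped-unword []      a k ks = ≡.refl
swapped-unword (x ∷ r) a k ks =
  ≡.trans (swapped-unword r (suc a) k ks) (≡.cong (flip r) (pow-∷ y a _))
swapped-unword (y ∷ r) a k ks = swapped-unword r 0 (suc a) (k ∷ ks)

-- For `a = 0` this is one half of the involutivity of duality. A general `a` is carried because the
-- letters x of the last part become letters y before the first letter y is met.
swapped-index : ∀ r a → swapped (unword r (suc a) []) ≡ flip r (pow y a [])
swapped-index []      a = ≡.refl
swapped-index (x ∷ r) a = ≡.trans (swapped-index r (suc a)) (≡.cong (flip r) (pow-∷ y a _))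
swapped-index (y ∷ r) a = swapped-unword r 0 (suc (suc a)) []

build-++ : ∀ ps qs → build (ps ++ qs) ≡ build ps ++ build qs
build-++ []             qs = ≡.refl
build-++ ((a , b) ∷ ps) qs =
  ≡.trans (≡.cong (λ l → replicate (a ∸ 1) 1 ++ (suc b ∷ l)) (build-++ ps qs)) (≡.sym (++-assoc (replicate (a ∸ 1) 1) _ _))

build-reverse : ∀ p ps → build (map swap (reverse (p ∷ ps))) ≡ build (map swap (reverse ps)) ++ build (swap p ∷ [])
build-reverse p ps =
  ≡.trans (≡.cong (λ l → build (map swap l)) (unfold-reverse p ps))
  (≡.trans (≡.cong build (map-++ swap (reverse ps) (p ∷ [])))
         (build-++ (map swap (reverse ps)) (swap p ∷ [])))

unword-ypow : ∀ n r a ks → unword (pow y n (y ∷ r)) a ks ≡ unword r 0 (replicate n 1 ++ suc a ∷ ks)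
unword-ypow zero    r a ks = ≡.refl
unword-ypow (suc n) r a ks = unword-ypow n (y ∷ r) a ks

unword-ypow-[] : ∀ n a ks → unword (pow y n []) a ks ≡ replicate n 1 ++ suc a ∷ ks
unword-ypow-[] zero    a ks = ≡.refl
unword-ypow-[] (suc n) a ks = unword-ypow n [] a ks

-- The pairs are reversed before `build`, so reading the index from the left produces the dual from
-- the right. Hence the induction carries `suf`, the parts of the dual completed so far, and `c`,
-- the number of 1's read, each of which is an x in the part under construction.
build-parse : ∀ k ks → Admissible (k ∷ ks) → ∀ c suf →
  build (map swap (reverse (parse (k ∷ ks) c))) ++ suf ≡ unword (x ∷ core k ks) c suf
build-parse (suc (suc k)) [] _ c suf =
  ≡.trans (++-assoc (replicate k 1) _ suf) (≡.sym (unword-ypow-[] k (suc c) suf))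
build-parse (suc zero) [] (_ , s≤s ())
build-parse (suc zero) (k₂ ∷ ks) (_ ∷ ps , l) c suf = build-parse k₂ ks (ps , l) (suc c) suf
build-parse (suc (suc k)) (k₂ ∷ ks) (_ ∷ ps , l) c suf = begin
  build (map swap (reverse ((suc c , suc k) ∷ parse (k₂ ∷ ks) 0))) ++ suf
    ≡⟨ ≡.cong (_++ suf) (build-reverse (suc c , suc k) (parse (k₂ ∷ ks) 0)) ⟩
  (build (map swap (reverse (parse (k₂ ∷ ks) 0))) ++ (replicate k 1 ++ suc (suc c) ∷ [])) ++ suf
    ≡⟨ ++-assoc (build (map swap (reverse (parse (k₂ ∷ ks) 0)))) _ suf ⟩
  build (map swap (reverse (parse (k₂ ∷ ks) 0))) ++ ((replicate k 1 ++ suc (suc c) ∷ []) ++ suf)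
    ≡⟨ ≡.cong (build (map swap (reverse (parse (k₂ ∷ ks) 0))) ++_) (++-assoc (replicate k 1) _ suf) ⟩
  build (map swap (reverse (parse (k₂ ∷ ks) 0))) ++ (replicate k 1 ++ suc (suc c) ∷ suf)
    ≡⟨ build-parse k₂ ks (ps , l) 0 _ ⟩
  unword (x ∷ core k₂ ks) 0 (replicate k 1 ++ suc (suc c) ∷ suf)
    ≡⟨ unword-ypow k (x ∷ core k₂ ks) (suc c) suf ⟨
  unword (pow y k (y ∷ x ∷ core k₂ ks)) (suc c) suf ∎
  where open ≡.≡-Reasoning

dual-index : ∀ k ks → Admissible (k ∷ ks) → dual (k ∷ ks) ≡ index (x ∷ core k ks)
dual-index k ks p = ≡.trans (≡.sym (++-identityʳ _)) (build-parse k ks p 0 [])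

-- All that is needed to run an induction along the dual index; the last component is involutivity
-- of duality at the level of words.
dual-∷ : ∀ k ks → Admissible (k ∷ ks) → ∃₂ λ k′ ks′ →
  dual (k ∷ ks) ≡ k′ ∷ ks′ × Admissible (k′ ∷ ks′) × x ∷ core k′ ks′ ≡ word (k ∷ ks)
dual-∷ k ks p with dual (k ∷ ks) | dual-index k ks p
... | _ | ≡.refl with unword (core k ks) 1 [] | unword-∷ (core k ks) 1 [] | index-admissible (core k ks) | swapped-index (core k ks) 0
...   | _ | k′ , ks′ , ≡.refl | adm | eq = k′ , ks′ , ≡.refl , adm , ≡.trans eq (≡.sym (word-flip k ks p))

-- Block decompositions

Blocks : Set
Blocks = List (List ℕ)

data NonemptyHead : Blocks → Set where
  nonempty : ∀ b bs bss → NonemptyHead ((b ∷ bs) ∷ bss)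

-- The first half keeps `consHead` away from its default case; the second makes the exponent of
-- -t(1-t), a truncated difference, a true one.
blocks-go-shape : ∀ k ks → All (λ bs → NonemptyHead bs × length bs ≤ suc (length ks)) (blocks-go k ks)
blocks-go-shape k []        = (nonempty k [] [] , s≤s z≤n) ∷ []
blocks-go-shape k (k₂ ∷ ks) = ++⁺
  (map⁺ (All.map (λ { (nonempty b bs bss , l) → nonempty k (b ∷ bs) bss , ℕ.m≤n⇒m≤1+n l }) (blocks-go-shape k₂ ks)))
  (map⁺ (All.map (λ { {bs} (_ , l) → nonempty k [] bs , s≤s l }) (blocks-go-shape k₂ ks)))

consHead : ℕ → Blocks → Blocks
consHead k []       = []
consHead k (b ∷ bs) = (k ∷ b) ∷ bs

blocks-go-∷ : ∀ k k₂ ks → blocks-go k (k₂ ∷ ks) ≡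
  map (consHead k) (blocks-go k₂ ks) ++ map ((k ∷ []) ∷_) (blocks-go k₂ ks)
blocks-go-∷ k k₂ ks = ≡.cong (_++ map ((k ∷ []) ∷_) (blocks-go k₂ ks))
  (map-cong (λ { [] → ≡.refl ; (b ∷ bs) → ≡.refl }) (blocks-go k₂ ks))

-- The product prodF when the first block is still to be enlarged by i parts of total K; δ is the shift
-- of k′₁ = k₁ + 1.
prodF′ : ℕ → ℕ → ℕ → Blocks → List ℕ → Poly
prodF′ i K δ (b ∷ bs) (e ∷ es) = pmul (f (i + (length b ∸ 1)) (K + sum b + δ) e) (prodF false bs es)
prodF′ i K δ _        _        = pone

sums′ : ℕ → Blocks → Index
sums′ K []       = []
sums′ K (b ∷ bs) = (K + sum b) ∷ map sum bs

prodF-false : ∀ bs e → prodF false bs e ≡ prodF′ 0 0 0 bs e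
prodF-false []       e       = ≡.refl
prodF-false (b ∷ bs) []      = ≡.refl
prodF-false (b ∷ bs) (e ∷ es) = ≡.refl

prodF-true : ∀ bs e → prodF true bs e ≡ prodF′ 0 0 1 bs e
prodF-true []       e       = ≡.refl
prodF-true (b ∷ bs) []      = ≡.refl
prodF-true (b ∷ bs) (e ∷ es) = ≡.refl

sums-0 : ∀ bs → map sum bs ≡ sums′ 0 bs
sums-0 []       = ≡.refl
sums-0 (b ∷ bs) = ≡.refl

g-∷ : ∀ m k ks → g m (k ∷ ks) ≡ concatMap (λ bs → map (λ e →
  (pmul (ppow minusTOneMinusT (suc (length ks) ∸ length bs)) (prodF true bs e) , (map sum bs ⊕ e)))
  (comps (length bs) m)) (blocks-go k ks)
g-∷ zero    k ks = ≡.refl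
g-∷ (suc m) k ks = ≡.refl

-- Checked on unnormalised fractions, where no common factors have to be cancelled.
ℕ→ℚ-+ : ∀ m n → ℕ→ℚ (m + n) ≡ ℕ→ℚ m +ℚ ℕ→ℚ n
ℕ→ℚ-+ m n = ℚ.toℚᵘ-injective (begin
  toℚᵘ (ℕ→ℚ (m + n))                    ≈⟨ ℚ.toℚᵘ-fromℚᵘ _ ⟩
  ℚᵘ.mkℚᵘ (+ (m + n)) 0                  ≈⟨ ℚᵘ.*≡* (≡.cong (ℤ._* + 1) eq) ⟩
  ℚᵘ.mkℚᵘ (+ m) 0 ℚᵘ.+ ℚᵘ.mkℚᵘ (+ n) 0   ≈⟨ ℚᵘ.+-cong (ℚ.toℚᵘ-fromℚᵘ (ℚᵘ.mkℚᵘ (+ m) 0)) (ℚ.toℚᵘ-fromℚᵘ (ℚᵘ.mkℚᵘ (+ n) 0)) ⟨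
  toℚᵘ (ℕ→ℚ m) ℚᵘ.+ toℚᵘ (ℕ→ℚ n)        ≈⟨ ℚ.toℚᵘ-homo-+ (ℕ→ℚ m) (ℕ→ℚ n) ⟨
  toℚᵘ (ℕ→ℚ m +ℚ ℕ→ℚ n)                 ∎)
  where
  open SetoidReasoning ℚᵘ.≃-setoid
  eq : + (m + n) ≡ (+ m ℤ.* + 1) ℤ.+ (+ n ℤ.* + 1)
  eq = ≡.trans (ℤ.pos-+ m n) (≡.sym (≡.cong₂ ℤ._+_ (ℤ.*-identityʳ (+ m)) (ℤ.*-identityʳ (+ n))))

-- Operators on functions of words

-- The endomorphism plays the role of multiplication by t.
record LinearEndomorphism {c ℓ : Level} (M : Module +-*-commutativeRing c ℓ) : Set (c ⊔ ℓ) where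
  open Module M
  field
    τ      : Carrierᴹ → Carrierᴹ
    τ-cong : ∀ {a b} → a ≈ᴹ b → τ a ≈ᴹ τ b
    τ-+    : ∀ a b → τ (a +ᴹ b) ≈ᴹ τ a +ᴹ τ b
    τ-*ₗ   : ∀ q a → τ (q *ₗ a) ≈ᴹ q *ₗ τ a

module Operators {c ℓ : Level} (M : Module +-*-commutativeRing c ℓ) (endo : LinearEndomorphism M) where

  open Module M
  open LinearEndomorphism endo

  private module T = AbelianGroupProperties +ᴹ-abelianGroup

  τ-0 : τ 0ᴹ ≈ᴹ 0ᴹ
  τ-0 = T.identityˡ-unique (τ 0ᴹ) (τ 0ᴹ)
          (≈ᴹ-trans (≈ᴹ-sym (τ-+ 0ᴹ 0ᴹ)) (τ-cong (+ᴹ-identityˡ 0ᴹ)))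

  private
    W-group V-group : AbelianGroup _ _
    W-group = Pointwise.abelianGroup Word +ᴹ-abelianGroup
    V-group = Pointwise.abelianGroup ℕ W-group

  module W = AbelianGroup W-group

  -- An element F : V is a power series in λ with coefficients functions on words; F m w is the
  -- coefficient of λᵐ at w.
  open AbelianGroup V-group public
    using (_≈_; refl; sym; trans; setoid)
    renaming ( Carrier to V; _∙_ to _⊹_; ∙-cong to ⊹-cong; ε to 0#; _⁻¹ to -_; ⁻¹-cong to neg-cong
             ; assoc to ⊹-assoc; comm to ⊹-comm; identityˡ to ⊹-identityˡ; identityʳ to ⊹-identityʳ
             ; inverseˡ to -‿inverseˡ; inverseʳ to -‿inverseʳ; ∙-congˡ to ⊹-congˡ; ∙-congʳ to ⊹-congʳ)
  open AbelianGroupProperties V-group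
  open CommutativeSemigroupProperties (AbelianGroup.commutativeSemigroup V-group) using (interchange)
  open SetoidReasoning setoid

  lamT : (ℕ → Carrierᴹ) → ℕ → Carrierᴹ
  lamT s zero    = 0ᴹ
  lamT s (suc m) = s m

  lamV : V → V
  lamV F m w = lamT (λ m′ → F m′ w) m

  tV : V → V
  tV F m w = τ (F m w)

  lamV-cong : ∀ {F G} → F ≈ G → lamV F ≈ lamV G
  lamV-cong p zero    w = ≈ᴹ-refl
  lamV-cong p (suc m) w = p m w

  lamV-+ : ∀ F G → lamV (F ⊹ G) ≈ lamV F ⊹ lamV G
  lamV-+ F G zero    w = ≈ᴹ-sym (+ᴹ-identityˡ 0ᴹ)
  lamV-+ F G (suc m) w = ≈ᴹ-refl

  lamV-tV : ∀ F → lamV (tV F) ≈ tV (lamV F)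
  lamV-tV F zero    w = ≈ᴹ-sym τ-0
  lamV-tV F (suc m) w = ≈ᴹ-refl

  tV-cong : ∀ {F G} → F ≈ G → tV F ≈ tV G
  tV-cong p m w = τ-cong (p m w)

  tV-+ : ∀ F G → tV (F ⊹ G) ≈ tV F ⊹ tV G
  tV-+ F G m w = τ-+ _ _

  infixr 9 _∘_
  infixl 6 _⊞_

  record Op : Set (c ⊔ ℓ) where
    infixr 7 _·_
    field
      _·_    : V → V
      ·-cong : ∀ {F G} → F ≈ G → _·_ F ≈ _·_ G
      ·-+    : ∀ F G → _·_ (F ⊹ G) ≈ _·_ F ⊹ _·_ G
      ·-t    : ∀ F → _·_ (tV F) ≈ tV (_·_ F)
      ·-lam  : ∀ F → _·_ (lamV F) ≈ lamV (_·_ F)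
  open Op public

  ·-0 : ∀ A → A · 0# ≈ 0#
  ·-0 A = identityˡ-unique (A · 0#) (A · 0#)
            (trans (sym (·-+ A 0# 0#)) (·-cong A (⊹-identityˡ 0#)))

  ·-neg : ∀ A F → A · (- F) ≈ - (A · F)
  ·-neg A F = inverseˡ-unique (A · (- F)) (A · F)
    (trans (sym (·-+ A (- F) F)) (trans (·-cong A (-‿inverseˡ F)) (·-0 A)))

  -- Operators not involving λ: these are the U for which 1 - λ U is inverted degree by degree.
  record LevelOp : Set (c ⊔ ℓ) where
    infixr 7 _·W_
    field
      _·W_    : W.Carrier → W.Carrier
      ·W-cong : ∀ {F G} → F W.≈ G → _·W_ F W.≈ _·W_ G
      ·W-+    : ∀ F G → _·W_ (F W.∙ G) W.≈ _·W_ F W.∙ _·W_ G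
      ·W-t    : ∀ F → _·W_ (λ w → τ (F w)) W.≈ (λ w → τ (_·W_ F w))
  open LevelOp public

  idO : Op
  idO = record
    { _·_ = λ F → F ; ·-cong = λ p → p ; ·-+ = λ F G → refl {F ⊹ G}
    ; ·-t = λ F → refl {tV F} ; ·-lam = λ F → refl {lamV F} }

  _∘_ : Op → Op → Op
  A ∘ B = record
    { _·_    = λ F → A · B · F
    ; ·-cong = λ p → ·-cong A (·-cong B p)
    ; ·-+    = λ F G → trans (·-cong A (·-+ B F G)) (·-+ A _ _)
    ; ·-t    = λ F → trans (·-cong A (·-t B F)) (·-t A _)
    ; ·-lam  = λ F → trans (·-cong A (·-lam B F)) (·-lam A _) }

  _⊞_ : Op → Op → Op
  A ⊞ B = record
    { _·_    = λ F → (A · F) ⊹ (B · F)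
    ; ·-cong = λ p → ⊹-cong (·-cong A p) (·-cong B p)
    ; ·-+    = λ F G → trans (⊹-cong (·-+ A F G) (·-+ B F G)) (interchange _ _ _ _)
    ; ·-t    = λ F → trans (⊹-cong (·-t A F) (·-t B F)) (sym (tV-+ _ _))
    ; ·-lam  = λ F → trans (⊹-cong (·-lam A F) (·-lam B F)) (sym (lamV-+ _ _)) }

  tO : Op
  tO = record
    { _·_ = tV ; ·-cong = tV-cong ; ·-+ = tV-+ ; ·-t = λ F → refl {tV (tV F)}
    ; ·-lam = λ F → sym (lamV-tV F) }

  lamO : Op
  lamO = record
    { _·_ = lamV ; ·-cong = lamV-cong ; ·-+ = lamV-+ ; ·-t = lamV-tV
    ; ·-lam = λ F → refl {lamV (lamV F)} }

  negO : Op
  negO = record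
    { _·_ = -_ ; ·-cong = neg-cong ; ·-+ = λ F G → sym (⁻¹-∙-comm F G)
    ; ·-t = λ F → sym (·-neg tO F) ; ·-lam = λ F → sym (·-neg lamO F) }

  lift : LevelOp → Op
  lift U = record
    { _·_    = λ F m → U ·W (F m)
    ; ·-cong = λ p m → ·W-cong U (p m)
    ; ·-+    = λ F G m → ·W-+ U (F m) (G m)
    ; ·-t    = λ F m → ·W-t U (F m)
    ; ·-lam  = λ { F zero    → lift-0
                 ; F (suc m) → W.refl {U ·W (F m)} } }
    where
    lift-0 : U ·W W.ε W.≈ W.ε
    lift-0 = AbelianGroupProperties.identityˡ-unique W-group (U ·W W.ε) (U ·W W.ε)
      (W.trans (W.sym (·W-+ U W.ε W.ε)) (·W-cong U (W.identityˡ W.ε)))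

  letterW : Letter → LevelOp
  letterW a = record
    { _·W_ = λ F w → F (a ∷ w) ; ·W-cong = λ p w → p (a ∷ w)
    ; ·W-+ = λ _ _ _ → ≈ᴹ-refl ; ·W-t = λ _ _ → ≈ᴹ-refl }

  txW ytxW : LevelOp
  txW = record
    { _·W_ = λ F w → τ (F (x ∷ w)) ; ·W-cong = λ p w → τ-cong (p (x ∷ w))
    ; ·W-+ = λ _ _ _ → τ-+ _ _ ; ·W-t = λ _ _ → ≈ᴹ-refl }
  ytxW = record
    { _·W_ = λ F w → F (y ∷ w) +ᴹ τ (F (x ∷ w))
    ; ·W-cong = λ p w → +ᴹ-cong (p (y ∷ w)) (τ-cong (p (x ∷ w)))
    ; ·W-+ = λ F G w → ≈ᴹ-trans (+ᴹ-cong ≈ᴹ-refl (τ-+ _ _))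
        (CommutativeSemigroupProperties.interchange (AbelianGroup.commutativeSemigroup +ᴹ-abelianGroup) _ _ _ _)
    ; ·W-t = λ _ _ → ≈ᴹ-sym (τ-+ _ _) }

  X Y tX Y+tX : Op
  X    = lift (letterW x)
  Y    = lift (letterW y)
  tX   = lift txW
  Y+tX = lift ytxW

  -- geom U = (1 - λ U)⁻¹
  geom : LevelOp → V → V
  geom U F zero    = F zero
  geom U F (suc m) = F (suc m) W.∙ (U ·W geom U F m)

  geom-fix : ∀ U F → geom U F ≈ F ⊹ lamV (lift U · geom U F)
  geom-fix U F zero    w = ≈ᴹ-sym (+ᴹ-identityʳ _)
  geom-fix U F (suc m) w = ≈ᴹ-refl

  -- The equation determines each degree in λ from the previous one. Identities for geometric series
  -- are proved below by checking this equation.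
  geom-unique : ∀ U {F G} → G ≈ F ⊹ lamV (lift U · G) → G ≈ geom U F
  geom-unique U p zero    w = ≈ᴹ-trans (p zero w) (+ᴹ-identityʳ _)
  geom-unique U p (suc m) w = ≈ᴹ-trans (p (suc m) w)
    (+ᴹ-cong ≈ᴹ-refl (·W-cong U (geom-unique U p m) w))

  geomO : LevelOp → Op
  geomO U = record
    { _·_    = geom U
    ; ·-cong = λ {F} {G} p → geom-unique U (trans (geom-fix U F) (⊹-congʳ p))
    ; ·-+    = λ F G → sym (geom-unique U (begin
        geom U F ⊹ geom U G
          ≈⟨ ⊹-cong (geom-fix U F) (geom-fix U G) ⟩
        (F ⊹ lamV (lift U · geom U F)) ⊹ (G ⊹ lamV (lift U · geom U G))
          ≈⟨ interchange _ _ _ _ ⟩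
        (F ⊹ G) ⊹ (lamV (lift U · geom U F) ⊹ lamV (lift U · geom U G))
          ≈⟨ ⊹-congˡ (·-+ (lamO ∘ lift U) _ _) ⟨
        (F ⊹ G) ⊹ lamV (lift U · (geom U F ⊹ geom U G)) ∎))
    ; ·-t    = λ F → sym (geom-unique U (begin
        tV (geom U F)                               ≈⟨ tV-cong (geom-fix U F) ⟩
        tV (F ⊹ lamV (lift U · geom U F))           ≈⟨ tV-+ _ _ ⟩
        tV F ⊹ tV (lamV (lift U · geom U F))        ≈⟨ ⊹-congˡ (·-t (lamO ∘ lift U) _) ⟨
        tV F ⊹ lamV (lift U · tV (geom U F))        ∎))
    ; ·-lam  = λ F → sym (geom-unique U (begin
        lamV (geom U F)                             ≈⟨ lamV-cong (geom-fix U F) ⟩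
        lamV (F ⊹ lamV (lift U · geom U F))         ≈⟨ lamV-+ _ _ ⟩
        lamV F ⊹ lamV (lamV (lift U · geom U F))    ≈⟨ ⊹-congˡ (·-lam (lamO ∘ lift U) _) ⟨
        lamV F ⊹ lamV (lift U · lamV (geom U F))    ∎)) }

  geom-intertwine : ∀ (A : Op) U U′ →
    (∀ F → lift U · A · F ≈ A · lift U′ · F) → ∀ F → geom U (A · F) ≈ A · geom U′ F
  geom-intertwine A U U′ p F = sym (geom-unique U (begin
    A · geom U′ F                                  ≈⟨ ·-cong A (geom-fix U′ F) ⟩
    A · (F ⊹ lamV (lift U′ · geom U′ F))           ≈⟨ ·-+ A _ _ ⟩
    (A · F) ⊹ (A · lamV (lift U′ · geom U′ F))     ≈⟨ ⊹-congˡ (·-lam A _) ⟩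
    (A · F) ⊹ lamV (A · lift U′ · geom U′ F)       ≈⟨ ⊹-congˡ (lamV-cong (p _)) ⟨
    (A · F) ⊹ lamV (lift U · A · geom U′ F)        ∎))

  -- run β h r F is the value of F at the image of the word r under the substitution h, preceded by β.
  run : Op → (Letter → Op) → Word → V → ℕ → Carrierᴹ
  run β h []      F m = (β · F) m []
  run β h (a ∷ r) F m = run β h r (h a · F) m

  run-cong : ∀ β h r {F G} → F ≈ G → ∀ m → run β h r F m ≈ᴹ run β h r G m
  run-cong β h []      p m = ·-cong β p m []
  run-cong β h (a ∷ r) p m = run-cong β h r (·-cong (h a) p) m

  -- By the definition of `run`, the letter operator of `a` followed by `substitute β h` is
  -- definitionally `substitute β h` followed by `h a`. Many steps below rest on this without
  -- mention.
  substitute : Op → (Letter → Op) → Op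
  substitute β h = record
    { _·_    = λ F m r → run β h r F m
    ; ·-cong = λ p m r → run-cong β h r p m
    ; ·-+    = λ F G m r → run-+ r F G m
    ; ·-t    = λ F m r → run-t r F m
    ; ·-lam  = λ F m r → run-lam r F m }
    where
    run-+ : ∀ r F G m → run β h r (F ⊹ G) m ≈ᴹ run β h r F m +ᴹ run β h r G m
    run-+ []      F G m = ·-+ β F G m []
    run-+ (a ∷ r) F G m = ≈ᴹ-trans (run-cong β h r (·-+ (h a) F G) m) (run-+ r _ _ m)
    run-t : ∀ r F m → run β h r (tV F) m ≈ᴹ τ (run β h r F m)
    run-t []      F m = ·-t β F m []
    run-t (a ∷ r) F m = ≈ᴹ-trans (run-cong β h r (·-t (h a) F) m) (run-t r _ m)
    run-lam : ∀ r F m → run β h r (lamV F) m ≈ᴹ lamT (run β h r F) m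
    run-lam []      F m = ·-lam β F m []
    run-lam (a ∷ r) F m = ≈ᴹ-trans (run-cong β h r (·-lam (h a) F) m) (run-lam r _ m)

  -- `A` is moved outwards past one letter at a time, and `β` receives it at the start of the word.
  -- When `A` is itself a substitution, this composes two substitutions.
  run-intertwine : ∀ (A : Op) {β β′ h h′} →
    (∀ F m → (β · A · F) m [] ≈ᴹ (β′ · F) m []) →
    (∀ a F → h a · A · F ≈ A · h′ a · F) →
    ∀ r F m → run β h r (A · F) m ≈ᴹ run β′ h′ r F m
  run-intertwine A b s []      F m = b F m
  run-intertwine A {β} {h = h} b s (a ∷ r) F m =
    ≈ᴹ-trans (run-cong β h r (s a F) m) (run-intertwine A b s r _ m)

  -- D = 1 - λ t X and N = - t (1 - t)
  G_X G_Y G_tX G_Y+tX D N : Op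
  G_X    = geomO (letterW x)
  G_Y    = geomO (letterW y)
  G_tX   = geomO txW
  G_Y+tX = geomO ytxW
  D      = idO ⊞ negO ∘ lamO ∘ tX
  N      = negO ∘ tO ⊞ tO ∘ tO

  -- hψ and hθσ are the composites σ ∘ Q and σ ∘ θ.
  hP hQ hσ hψ hθ hθσ hC : Letter → Op
  hP x = X
  hP y = Y ∘ G_X
  hQ x = G_Y ∘ X
  hQ y = Y
  hσ x = X
  hσ y = Y+tX
  hψ x = G_Y+tX ∘ X
  hψ y = Y+tX
  hθ x = X ∘ G_tX
  hθ y = Y ∘ D ∘ G_X ⊞ N ∘ lamO ∘ X ∘ X ∘ G_X
  hθσ x = X ∘ G_tX
  hθσ y = Y ∘ G_X ∘ D ⊞ tX
  hC x = X ∘ G_tX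
  hC y = Y ∘ D ⊞ tX

  T_P T_Q T_σ : Op
  T_P = substitute G_X hP
  T_Q = substitute idO hQ
  T_σ = substitute idO hσ

  -- Commuting operators

  infix 4 _⇄_
  _⇄_ : Op → Op → Set _
  A ⇄ B = ∀ F → A · B · F ≈ B · A · F

  ∘-⇄ : ∀ A B E → A ⇄ E → B ⇄ E → A ∘ B ⇄ E
  ∘-⇄ A B E p q F = trans (·-cong A (q F)) (p _)

  ⊞-⇄ : ∀ A B E → A ⇄ E → B ⇄ E → A ⊞ B ⇄ E
  ⊞-⇄ A B E p q F = trans (⊹-cong (p F) (q F)) (sym (·-+ E _ _))

  geom-⇄ : ∀ A U → A ⇄ lift U → A ⇄ geomO U
  geom-⇄ A U p F = sym (geom-intertwine A U U (λ F → sym (p F)) F)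

  t-⇄ : ∀ A → tO ⇄ A
  t-⇄ A F = sym (·-t A F)

  lam-⇄ : ∀ A → lamO ⇄ A
  lam-⇄ A F = sym (·-lam A F)

  neg-⇄ : ∀ A → negO ⇄ A
  neg-⇄ A F = sym (·-neg A F)

  N-⇄ : ∀ A → N ⇄ A
  N-⇄ A = ⊞-⇄ (negO ∘ tO) (tO ∘ tO) A (∘-⇄ negO tO A (neg-⇄ A) (t-⇄ A)) (∘-⇄ tO tO A (t-⇄ A) (t-⇄ A))

  ⇄-tX : ∀ A → A ⇄ X → A ⇄ tX
  ⇄-tX A p F = trans (·-t A (X · F)) (tV-cong (p F))

  ⇄-D : ∀ A → A ⇄ X → A ⇄ D
  ⇄-D A p F = sym (⊞-⇄ idO (negO ∘ lamO ∘ tX) A (λ G → refl {A · G})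
    (∘-⇄ negO (lamO ∘ tX) A (neg-⇄ A) (∘-⇄ lamO tX A (lam-⇄ A) λ G → sym (⇄-tX A p G))) F)

  ⇄-G_X : ∀ A → A ⇄ X → A ⇄ G_X
  ⇄-G_X A = geom-⇄ A (letterW x)

  ⇄-G_tX : ∀ A → A ⇄ X → A ⇄ G_tX
  ⇄-G_tX A p = geom-⇄ A txW (⇄-tX A p)

  X⇄X : X ⇄ X
  X⇄X F = refl {X · X · F}

  G_X⇄X : G_X ⇄ X
  G_X⇄X F = sym (⇄-G_X X X⇄X F)

  G_tX⇄X : G_tX ⇄ X
  G_tX⇄X F = sym (⇄-G_tX X X⇄X F)

  D⇄X : D ⇄ X
  D⇄X F = sym (⇄-D X X⇄X F)

  -- Intertwining relations among the substitutions

  cancel-middle : ∀ a c d → (a ⊹ (- c)) ⊹ (d ⊹ c) ≈ a ⊹ d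
  cancel-middle a c d = begin
    (a ⊹ (- c)) ⊹ (d ⊹ c)   ≈⟨ ⊹-congˡ (⊹-comm d c) ⟩
    (a ⊹ (- c)) ⊹ (c ⊹ d)   ≈⟨ ⊹-assoc a (- c) (c ⊹ d) ⟩
    a ⊹ ((- c) ⊹ (c ⊹ d))   ≈⟨ ⊹-congˡ (⊹-assoc (- c) c d) ⟨
    a ⊹ (((- c) ⊹ c) ⊹ d)   ≈⟨ ⊹-congˡ (⊹-congʳ (-‿inverseˡ c)) ⟩
    a ⊹ (0# ⊹ d)            ≈⟨ ⊹-congˡ (⊹-identityˡ d) ⟩
    a ⊹ d                   ∎

  D-G_tX : ∀ F → D · G_tX · F ≈ F
  D-G_tX F = begin
    G ⊹ (- L)               ≈⟨ ⊹-congʳ (geom-fix txW F) ⟩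
    (F ⊹ L) ⊹ (- L)         ≈⟨ ⊹-assoc F L (- L) ⟩
    F ⊹ (L ⊹ (- L))         ≈⟨ ⊹-congˡ (-‿inverseʳ L) ⟩
    F ⊹ 0#                  ≈⟨ ⊹-identityʳ F ⟩
    F                       ∎
    where
    G L : V
    G = G_tX · F
    L = lamV (tX · G)

  -- Indeed tX(1 - λtX) - t(1-t)λX² = tX(1 - λX), and the factor 1 - λX cancels `G_X`. This is what
  -- the second term of `hθ y` is for.
  θ-merge : ∀ F → (tX · D · G_X · F) ⊹ (N · lamO · X · X · G_X · F) ≈ tX · F
  θ-merge F = begin
    tV (X · (G ⊹ (- lamV (tV (X · G))))) ⊹ ((- tV H) ⊹ tV (tV H))
      ≈⟨ ⊹-cong (tV-+ (X · G) _) (⊹-comm _ _) ⟩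
    (tV (X · G) ⊹ tV (- lamV (tV (X · X · G)))) ⊹ (tV (tV H) ⊹ (- tV H))
      ≈⟨ ⊹-congʳ (⊹-cong (trans (tV-cong (·-cong X (geom-fix (letterW x) F))) (tV-+ _ _)) (·-neg tO _)) ⟩
    ((tV (X · F) ⊹ tV H) ⊹ (- tV (lamV (tV (X · X · G))))) ⊹ (tV (tV H) ⊹ (- tV H))
      ≈⟨ ⊹-congʳ (⊹-congˡ (neg-cong (tV-cong (·-t lamO _)))) ⟩
    ((tV (X · F) ⊹ tV H) ⊹ (- tV (tV H))) ⊹ (tV (tV H) ⊹ (- tV H))
      ≈⟨ ⊹-assoc _ _ _ ⟩
    (tV (X · F) ⊹ tV H) ⊹ ((- tV (tV H)) ⊹ (tV (tV H) ⊹ (- tV H)))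
      ≈⟨ ⊹-congˡ (⊹-assoc _ _ _) ⟨
    (tV (X · F) ⊹ tV H) ⊹ (((- tV (tV H)) ⊹ tV (tV H)) ⊹ (- tV H))
      ≈⟨ ⊹-congˡ (⊹-congʳ (-‿inverseˡ _)) ⟩
    (tV (X · F) ⊹ tV H) ⊹ (0# ⊹ (- tV H))
      ≈⟨ ⊹-congˡ (⊹-identityˡ _) ⟩
    (tV (X · F) ⊹ tV H) ⊹ (- tV H)
      ≈⟨ ⊹-assoc _ _ _ ⟩
    tV (X · F) ⊹ (tV H ⊹ (- tV H))
      ≈⟨ ⊹-congˡ (-‿inverseʳ _) ⟩
    tV (X · F) ⊹ 0#
      ≈⟨ ⊹-identityʳ _ ⟩
    tX · F ∎
    where
    G H : V
    G = G_X · F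
    H = lamV (X · X · G)

  T_σ⇄X : T_σ ⇄ X
  T_σ⇄X F = refl {T_σ · X · F}

  -- At y, moving `Y` past `T_σ` turns it into `Y+tX`; the contribution of tX and the term with `N`
  -- then collapse by `θ-merge`.
  θσ-intertwine : ∀ a F → hθ a · T_σ · F ≈ T_σ · hθσ a · F
  θσ-intertwine x F = sym (·-cong X (⇄-G_tX T_σ T_σ⇄X F))
  θσ-intertwine y F = begin
    (Y · D · G_X · T_σ · F) ⊹ (N · lamO · X · X · G_X · T_σ · F)
      ≈⟨ ⊹-cong (·-cong (Y ∘ D) (⇄-G_X T_σ T_σ⇄X F)) (·-cong (N ∘ lamO ∘ X ∘ X) (⇄-G_X T_σ T_σ⇄X F)) ⟨
    (Y · D · T_σ · G) ⊹ (N · lamO · T_σ · X · X · G)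
      ≈⟨ ⊹-cong (·-cong Y (⇄-D T_σ T_σ⇄X G)) (sym (∘-⇄ N lamO T_σ (N-⇄ T_σ) (lam-⇄ T_σ) (X · X · G))) ⟨
    (T_σ · Y+tX · D · G) ⊹ (T_σ · N · lamO · X · X · G)
      ≈⟨ ·-+ T_σ _ _ ⟨
    T_σ · (((Y · D · G) ⊹ (tX · D · G)) ⊹ (N · lamO · X · X · G))
      ≈⟨ ·-cong T_σ (trans (⊹-assoc _ _ _) (⊹-cong (·-cong Y (sym (⇄-D G_X G_X⇄X F))) (θ-merge F))) ⟩
    T_σ · ((Y · G_X · D · F) ⊹ (tX · F)) ∎
    where
    G : V
    G = G_X · F

  Qσ-intertwine : ∀ a F → hQ a · T_σ · F ≈ T_σ · hψ a · F
  Qσ-intertwine x F = geom-intertwine T_σ (letterW y) ytxW (λ G → refl {T_σ · Y+tX · G}) (X · F)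
  Qσ-intertwine y F = refl {T_σ · Y+tX · F}

  -- `T_P` commutes with `X`, hence with `D` and `G_tX`, and turns `Y` into `Y ∘ G_X`.
  CP-intertwine : ∀ a F → hC a · T_P · F ≈ T_P · hθσ a · F
  CP-intertwine x F = ·-cong X (sym (⇄-G_tX T_P (λ G → refl {T_P · X · G}) F))
  CP-intertwine y F = begin
    (Y · D · T_P · F) ⊹ (tX · T_P · F)
      ≈⟨ ⊹-cong (·-cong Y (⇄-D T_P (λ G → refl {T_P · X · G}) F)) (·-t T_P (X · F)) ⟨
    (T_P · Y · G_X · D · F) ⊹ (T_P · tX · F)
      ≈⟨ ·-+ T_P _ _ ⟨
    T_P · ((Y · G_X · D · F) ⊹ (tX · F)) ∎

  CQ-intertwine : ∀ a F → hC a · T_Q · F ≈ T_Q · hψ a · F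
  CQ-intertwine x F = begin
    X · G_tX · T_Q · F           ≈⟨ G_tX⇄X (T_Q · F) ⟨
    G_tX · T_Q · G_Y · X · F     ≈⟨ geom-unique txW step ⟨
    T_Q · G                      ∎
    where
    G : V
    G = G_Y+tX · X · F
    -- The resolvent identity: in (1 - λY - λtX) G = XF the term λtXG is moved to the right and 1 -
    -- λY is inverted.
    step₁ : G ≈ G_Y · ((X · F) ⊹ lamV (tX · G))
    step₁ = geom-unique (letterW y) (begin
      G                                               ≈⟨ geom-fix ytxW (X · F) ⟩
      (X · F) ⊹ lamV ((Y · G) ⊹ (tX · G))             ≈⟨ ⊹-congˡ (lamV-+ _ _) ⟩
      (X · F) ⊹ (lamV (Y · G) ⊹ lamV (tX · G))        ≈⟨ ⊹-congˡ (⊹-comm _ _) ⟩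
      (X · F) ⊹ (lamV (tX · G) ⊹ lamV (Y · G))        ≈⟨ ⊹-assoc _ _ _ ⟨
      ((X · F) ⊹ lamV (tX · G)) ⊹ lamV (Y · G)        ∎)
    -- Since `T_Q ∘ G_Y ∘ X` is `X ∘ T_Q`, the factor `G_Y` is absorbed, which leaves the equation
    -- characterising `G_tX`.
    step : T_Q · G ≈ (T_Q · G_Y · X · F) ⊹ lamV (tX · T_Q · G)
    step = begin
      T_Q · G
        ≈⟨ ·-cong T_Q step₁ ⟩
      T_Q · G_Y · ((X · F) ⊹ lamV (tX · G))
        ≈⟨ ·-+ (T_Q ∘ G_Y) _ _ ⟩
      (T_Q · G_Y · X · F) ⊹ (T_Q · G_Y · lamV (tX · G))
        ≈⟨ ⊹-congˡ (·-lam (T_Q ∘ G_Y) _) ⟩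
      (T_Q · G_Y · X · F) ⊹ lamV (T_Q · G_Y · tX · G)
        ≈⟨ ⊹-congˡ (lamV-cong (·-t (T_Q ∘ G_Y) _)) ⟩
      (T_Q · G_Y · X · F) ⊹ lamV (tX · T_Q · G) ∎
  CQ-intertwine y F = begin
    (Y · D · T_Q · F) ⊹ (tX · T_Q · F)
      ≈⟨ ⊹-cong (·-cong Y step) (sym (·-t T_Q H)) ⟩
    (T_Q · Y · (F ⊹ (- lamV (tV H)))) ⊹ (T_Q · tV H)
      ≈⟨ ·-+ T_Q _ _ ⟨
    T_Q · ((Y · (F ⊹ (- lamV (tV H)))) ⊹ tV H)
      -- One step of the expansion H = XF + λYH makes the term λtYH appear with both signs.
      ≈⟨ ·-cong T_Q (⊹-congˡ (trans (tV-cong (geom-fix (letterW y) (X · F))) (trans (tV-+ _ _) (⊹-congˡ (sym (lamV-tV _)))))) ⟩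
    T_Q · (((Y · F) ⊹ (- lamV (tV (Y · H)))) ⊹ (tV (X · F) ⊹ lamV (tV (Y · H))))
      ≈⟨ ·-cong T_Q (cancel-middle (Y · F) _ (tX · F)) ⟩
    T_Q · Y+tX · F ∎
    where
    H : V
    H = G_Y · X · F
    step : D · T_Q · F ≈ T_Q · (F ⊹ (- lamV (tV H)))
    step = begin
      (T_Q · F) ⊹ (- lamV (tV (T_Q · H)))
        ≈⟨ ⊹-congˡ (neg-cong (lamV-cong (·-t T_Q H))) ⟨
      (T_Q · F) ⊹ (- lamV (T_Q · tV H))
        ≈⟨ ⊹-congˡ (neg-cong (·-lam T_Q (tV H))) ⟨
      (T_Q · F) ⊹ (- (T_Q · lamV (tV H)))
        ≈⟨ ⊹-congˡ (·-neg T_Q _) ⟨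
      (T_Q · F) ⊹ (T_Q · (- lamV (tV H)))
        ≈⟨ ·-+ T_Q _ _ ⟨
      T_Q · (F ⊹ (- lamV (tV H))) ∎

  -- `hC x` is also `G_tX ∘ X`, so it sees only the values at words ending in x. Those are the words
  -- for which the Ohno-type relation is available.
  hC-x-cong : ∀ {F G} → X · F ≈ X · G → hC x · F ≈ hC x · G
  hC-x-cong {F} {G} p = begin
    X · G_tX · F  ≈⟨ G_tX⇄X F ⟨
    G_tX · X · F  ≈⟨ ·-cong G_tX p ⟩
    G_tX · X · G  ≈⟨ G_tX⇄X G ⟩
    X · G_tX · G  ∎

-- Finite sums and convolutions

module Sums {c ℓ : Level} (M : Module +-*-commutativeRing c ℓ) where
  open Module M
  open CommutativeSemigroupProperties (AbelianGroup.commutativeSemigroup +ᴹ-abelianGroup)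
    using () renaming (interchange to +ᴹ-interchange)

  private
    variable
      a b : Level
      A : Set a
      B : Set b

  Σ : (A → Carrierᴹ) → List A → Carrierᴹ
  Σ h as = sumᴹ M (map h as)

  Σ-cong-All : ∀ {h h′ : A → Carrierᴹ} {as} → All (λ a → h a ≈ᴹ h′ a) as → Σ h as ≈ᴹ Σ h′ as
  Σ-cong-All []       = ≈ᴹ-refl
  Σ-cong-All (p ∷ ps) = +ᴹ-cong p (Σ-cong-All ps)

  Σ-cong : ∀ {h h′ : A → Carrierᴹ} → (∀ a → h a ≈ᴹ h′ a) → ∀ as → Σ h as ≈ᴹ Σ h′ as
  Σ-cong p []       = ≈ᴹ-refl
  Σ-cong p (a ∷ as) = +ᴹ-cong (p a) (Σ-cong p as)

  Σ-++ : ∀ (h : A → Carrierᴹ) as bs → Σ h (as ++ bs) ≈ᴹ Σ h as +ᴹ Σ h bs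
  Σ-++ h []       bs = ≈ᴹ-sym (+ᴹ-identityˡ _)
  Σ-++ h (a ∷ as) bs = ≈ᴹ-trans (+ᴹ-cong ≈ᴹ-refl (Σ-++ h as bs)) (≈ᴹ-sym (+ᴹ-assoc _ _ _))

  Σ-map : ∀ (h : B → Carrierᴹ) (f : A → B) as → Σ h (map f as) ≈ᴹ Σ (h ∘′ f) as
  Σ-map h f []       = ≈ᴹ-refl
  Σ-map h f (a ∷ as) = +ᴹ-cong ≈ᴹ-refl (Σ-map h f as)

  Σ-concatMap : ∀ (h : B → Carrierᴹ) (f : A → List B) as →
    Σ h (concatMap f as) ≈ᴹ Σ (λ a → Σ h (f a)) as
  Σ-concatMap h f []       = ≈ᴹ-refl
  Σ-concatMap h f (a ∷ as) = ≈ᴹ-trans (Σ-++ h (f a) _) (+ᴹ-cong ≈ᴹ-refl (Σ-concatMap h f as))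

  record Additive (φ : Carrierᴹ → Carrierᴹ) : Set (c ⊔ ℓ) where
    field
      cong : ∀ {s t} → s ≈ᴹ t → φ s ≈ᴹ φ t
      zer  : φ 0ᴹ ≈ᴹ 0ᴹ
      add  : ∀ s t → φ (s +ᴹ t) ≈ᴹ φ s +ᴹ φ t
  open Additive public

  Σ-additive : ∀ {φ} → Additive φ → ∀ (h : A → Carrierᴹ) as → φ (Σ h as) ≈ᴹ Σ (φ ∘′ h) as
  Σ-additive φ h []       = zer φ
  Σ-additive φ h (a ∷ as) = ≈ᴹ-trans (add φ _ _) (+ᴹ-cong ≈ᴹ-refl (Σ-additive φ h as))

  -- The sum of h j n over all j + n = m.
  conv : (ℕ → ℕ → Carrierᴹ) → ℕ → Carrierᴹ
  conv h zero    = h 0 0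
  conv h (suc m) = h 0 (suc m) +ᴹ conv (λ j → h (suc j)) m

  conv-cong : ∀ {h h′} → (∀ j n → h j n ≈ᴹ h′ j n) → ∀ m → conv h m ≈ᴹ conv h′ m
  conv-cong p zero    = p 0 0
  conv-cong p (suc m) = +ᴹ-cong (p 0 (suc m)) (conv-cong (λ j → p (suc j)) m)

  conv-0 : ∀ m → conv (λ _ _ → 0ᴹ) m ≈ᴹ 0ᴹ
  conv-0 zero    = ≈ᴹ-refl
  conv-0 (suc m) = ≈ᴹ-trans (+ᴹ-identityˡ _) (conv-0 m)

  conv-+ : ∀ h h′ m → conv (λ j n → h j n +ᴹ h′ j n) m ≈ᴹ conv h m +ᴹ conv h′ m
  conv-+ h h′ zero    = ≈ᴹ-refl
  conv-+ h h′ (suc m) = ≈ᴹ-trans (+ᴹ-cong ≈ᴹ-refl (conv-+ _ _ m)) (+ᴹ-interchange _ _ _ _)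

  conv-additive : ∀ {φ} → Additive φ → ∀ h m → φ (conv h m) ≈ᴹ conv (λ j n → φ (h j n)) m
  conv-additive φ h zero    = ≈ᴹ-refl
  conv-additive φ h (suc m) = ≈ᴹ-trans (add φ _ _) (+ᴹ-cong ≈ᴹ-refl (conv-additive φ _ m))

  -- Splits off the other end of the sum, as recursions in the second argument require.
  conv-last : ∀ h m → conv h (suc m) ≈ᴹ conv (λ j n → h j (suc n)) m +ᴹ h (suc m) 0
  conv-last h zero    = ≈ᴹ-refl
  conv-last h (suc m) =
    ≈ᴹ-trans (+ᴹ-cong ≈ᴹ-refl (conv-last (λ j → h (suc j)) m)) (≈ᴹ-sym (+ᴹ-assoc _ _ _))

  Σ-conv : ∀ (h : A → ℕ → ℕ → Carrierᴹ) as m →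
    Σ (λ a → conv (h a) m) as ≈ᴹ conv (λ j n → Σ (λ a → h a j n) as) m
  Σ-conv h []       m = ≈ᴹ-sym (conv-0 m)
  Σ-conv h (a ∷ as) m = ≈ᴹ-trans (+ᴹ-cong ≈ᴹ-refl (Σ-conv h as m)) (≈ᴹ-sym (conv-+ _ _ m))

  Σ-applyUpTo : ∀ m (f : ℕ → ℕ) (φ : ℕ → Carrierᴹ) h →
    (∀ j → φ (f j) ≈ᴹ h j (m ∸ j)) → Σ φ (applyUpTo f (suc m)) ≈ᴹ conv h m
  Σ-applyUpTo zero    f φ h p = ≈ᴹ-trans (+ᴹ-identityʳ _) (p 0)
  Σ-applyUpTo (suc m) f φ h p =
    +ᴹ-cong (p 0) (Σ-applyUpTo m (f ∘′ suc) φ (λ j → h (suc j)) (λ j → p (suc j)))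

  Σ-comps : ∀ (h : List ℕ → Carrierᴹ) r m →
    Σ h (comps (suc r) m) ≈ᴹ conv (λ j n → Σ (λ e → h (j ∷ e)) (comps r n)) m
  Σ-comps h r m = ≈ᴹ-trans (Σ-concatMap h (λ j → map (j ∷_) (comps r (m ∸ j))) (upTo (suc m)))
    (Σ-applyUpTo m (λ j → j) _ _ (λ j → Σ-map h (j ∷_) (comps r (m ∸ j))))

  constT : Carrierᴹ → ℕ → Carrierᴹ
  constT s zero    = s
  constT s (suc n) = 0ᴹ

  constT-cong : ∀ {s s′} → s ≈ᴹ s′ → ∀ m → constT s m ≈ᴹ constT s′ m
  constT-cong p zero    = p
  constT-cong p (suc m) = ≈ᴹ-refl

  Σ-comps-0 : ∀ h m → Σ h (comps 0 m) ≈ᴹ constT (h []) m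
  Σ-comps-0 h zero    = +ᴹ-identityʳ _
  Σ-comps-0 h (suc m) = ≈ᴹ-refl

  conv-constT : ∀ s m → conv (λ j → constT (s j)) m ≈ᴹ s m
  conv-constT s zero    = ≈ᴹ-refl
  conv-constT s (suc m) = ≈ᴹ-trans (+ᴹ-identityˡ _) (conv-constT (s ∘′ suc) m)

-- The sums of the theorem as substitutions

module Interpolation {c ℓ : Level} (M : Module +-*-commutativeRing c ℓ) (endo : LinearEndomorphism M) where

  open Module M
  open LinearEndomorphism endo
  open Operators M endo
  open Sums M
  open SetoidReasoning ≈ᴹ-setoid
  open CommutativeSemigroupProperties (AbelianGroup.commutativeSemigroup +ᴹ-abelianGroup)
    using () renaming (interchange to +ᴹ-interchange)
  open AbelianGroupProperties +ᴹ-abelianGroup using (inverseˡ-unique)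

  interpolate : ∀ F → X · T_Q · F ≈ X · T_P · F → ∀ r m →
    run G_X hθ (x ∷ r) (T_σ · F) m ≈ᴹ run idO hQ (x ∷ r) (T_σ · F) m
  interpolate F p r m = begin
    run G_X hθ (x ∷ r) (T_σ · F) m
      ≈⟨ run-intertwine T_σ (λ G m → ≈ᴹ-sym (⇄-G_X T_σ T_σ⇄X G m [])) θσ-intertwine (x ∷ r) F m ⟩
    run G_X hθσ (x ∷ r) F m
      ≈⟨ run-intertwine T_P (λ _ _ → ≈ᴹ-refl) CP-intertwine (x ∷ r) F m ⟨
    run idO hC (x ∷ r) (T_P · F) m
      -- The Ohno-type relation enters here, at the last letter x of the word.
      ≈⟨ run-cong idO hC r (hC-x-cong p) m ⟨
    run idO hC (x ∷ r) (T_Q · F) m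
      ≈⟨ run-intertwine T_Q (λ _ _ → ≈ᴹ-refl) CQ-intertwine (x ∷ r) F m ⟩
    run idO hψ (x ∷ r) F m
      ≈⟨ run-intertwine T_σ (λ _ _ → ≈ᴹ-refl) Qσ-intertwine (x ∷ r) F m ⟨
    run idO hQ (x ∷ r) (T_σ · F) m ∎

  -- The sum over k ⊕ e

  constV : (Word → Carrierᴹ) → V
  constV F m w = constT (F w) m

  powO : Op → ℕ → Op
  powO A zero    = idO
  powO A (suc n) = A ∘ powO A n

  letter : Letter → Op
  letter a = lift (letterW a)

  powO-letter : ∀ a n F m w → (powO (letter a) n · F) m w ≡ F m (pow a n w)
  powO-letter a zero    F m w = ≡.refl
  powO-letter a (suc n) F m w = powO-letter a n F m (a ∷ w)

  run-pow : ∀ β h a n w F m → run β h (pow a n w) F m ≡ run β h w (powO (h a) n · F) m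
  run-pow β h a zero    w F m = ≡.refl
  run-pow β h a (suc n) w F m = run-pow β h a n (a ∷ w) F m

  runI : (Letter → Op) → Index → Op
  runI h []       = idO
  runI h (k ∷ ks) = h y ∘ powO (h x) (k ∸ 1) ∘ runI h ks

  run-push : ∀ β h ks u F m → run β h (push ks u) F m ≡ run β h u (runI h ks · F) m
  run-push β h []       u F m = ≡.refl
  run-push β h (k ∷ ks) u F m = ≡.trans (run-push β h ks (pow x (k ∸ 1) (y ∷ u)) F m)
    (run-pow β h x (k ∸ 1) (y ∷ u) (runI h ks · F) m)

  run-word : ∀ β h k ks F m →
    run β h (word (k ∷ ks)) F m ≡ (β · powO (h x) (k ∸ 1) · runI h ks · F) m []
  run-word β h k ks F m = ≡.trans (run-push β h ks (pow x (k ∸ 1) []) F m)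
    (run-pow β h x (k ∸ 1) [] (runI h ks · F) m)

  geom-conv : ∀ a F m w → geom (letterW a) F m w ≈ᴹ conv (λ j n → F n (pow a j w)) m
  geom-conv a F zero    w = ≈ᴹ-refl
  geom-conv a F (suc m) w = +ᴹ-cong ≈ᴹ-refl (geom-conv a F m (a ∷ w))

  Realises : (Index → Carrierᴹ) → (Word → Carrierᴹ) → Set ℓ
  Realises H F = ∀ k ks → Positive ks → H (suc k ∷ ks) ≈ᴹ F (push ks (pow x k []))

  -- `u` is the stored word of the parts already enlarged. Enlarging the next part by j appends j
  -- more letters x, and summing over j gives `G_X`.
  insert-push : ∀ ks → Positive ks → ∀ u (H : Index → Carrierᴹ) (F : Word → Carrierᴹ) → (∀ zs → Positive zs → H zs ≈ᴹ F (push zs u)) →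
    ∀ m → Σ (λ e → H (ks ⊕ e)) (comps (length ks) m) ≈ᴹ (runI hP ks · constV F) m u
  insert-push []           _                u H F p m = ≈ᴹ-trans (Σ-comps-0 _ m) (constT-cong (p [] []) m)
  insert-push (suc k ∷ ks) (s≤s z≤n ∷ kspos) u H F p m = begin
    Σ (λ e → H ((suc k ∷ ks) ⊕ e)) (comps (suc (length ks)) m)
      ≈⟨ Σ-comps _ (length ks) m ⟩
    conv (λ j n → Σ (λ e → H (suc (k + j) ∷ (ks ⊕ e))) (comps (length ks) n)) m
      ≈⟨ conv-cong (λ j n → insert-push ks kspos (pow x (k + j) (y ∷ u)) (λ zs → H (suc (k + j) ∷ zs)) F
           (λ zs q → p (suc (k + j) ∷ zs) (s≤s z≤n ∷ q)) n) m ⟩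
    conv (λ j n → (R · constV F) n (pow x (k + j) (y ∷ u))) m
      ≈⟨ conv-cong (λ j n → ≈ᴹ-reflexive (≡.trans (≡.cong ((R · constV F) n) (pow-+ x k j (y ∷ u)))
           (≡.sym (powO-letter x k (R · constV F) n _)))) m ⟩
    conv (λ j n → (powO X k · R · constV F) n (pow x j (y ∷ u))) m
      ≈⟨ geom-conv x _ m (y ∷ u) ⟨
    (Y · G_X · powO X k · R · constV F) m u ∎
    where
    R : Op
    R = runI hP ks

  -- The leading y is not stored, so the increment of the first part comes from the `G_X` in front
  -- of the substitution.
  insert : ∀ k ks → Positive (k ∷ ks) → ∀ H F → Realises H F →
    ∀ m → Σ (λ e → H ((k ∷ ks) ⊕ e)) (comps (suc (length ks)) m) ≈ᴹ (T_P · constV F) m (word (k ∷ ks))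
  insert (suc k) ks (s≤s z≤n ∷ kspos) H F p m = begin
    Σ (λ e → H ((suc k ∷ ks) ⊕ e)) (comps (suc (length ks)) m)
      ≈⟨ Σ-comps _ (length ks) m ⟩
    conv (λ j n → Σ (λ e → H (suc (k + j) ∷ (ks ⊕ e))) (comps (length ks) n)) m
      ≈⟨ conv-cong (λ j n → insert-push ks kspos (pow x (k + j) []) (λ zs → H (suc (k + j) ∷ zs)) F
           (λ zs q → p (k + j) zs q) n) m ⟩
    conv (λ j n → (R · constV F) n (pow x (k + j) [])) m
      ≈⟨ conv-cong (λ j n → ≈ᴹ-reflexive (≡.trans (≡.cong ((R · constV F) n) (pow-+ x k j []))
           (≡.sym (powO-letter x k (R · constV F) n _)))) m ⟩
    conv (λ j n → (powO X k · R · constV F) n (pow x j [])) m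
      ≈⟨ geom-conv x _ m [] ⟨
    (G_X · powO X k · R · constV F) m []
      ≡⟨ run-word G_X hP (suc k) ks (constV F) m ⟨
    (T_P · constV F) m (word (suc k ∷ ks)) ∎
    where
    R : Op
    R = runI hP ks

  -- The sum over the dual index

  ·-conv : ∀ A K m r → (A · K) m r ≈ᴹ conv (λ j n → (A · constV (K j)) n r) m
  ·-conv A K m r = ≈ᴹ-trans (·-cong A split m r) (≈ᴹ-trans (·-+ A _ _ m r)
    (≈ᴹ-trans (+ᴹ-cong ≈ᴹ-refl (·-lam A K′ m r)) (rest m)))
    where
    K′ : V
    K′ m = K (suc m)
    -- The constant term and λ times the rest; as `A` commutes with λ, the expansion of `K` is
    -- carried through `A` degree by degree.
    split : K ≈ constV (K 0) ⊹ lamV K′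
    split zero    w = ≈ᴹ-sym (+ᴹ-identityʳ _)
    split (suc m) w = ≈ᴹ-sym (+ᴹ-identityˡ _)
    rest : ∀ m → (A · constV (K 0)) m r +ᴹ lamV (A · K′) m r ≈ᴹ conv (λ j n → (A · constV (K j)) n r) m
    rest zero    = +ᴹ-identityʳ _
    rest (suc m) = +ᴹ-cong ≈ᴹ-refl (·-conv A K′ m r)

  -- Here H is a function of the dual index, and x ∷ core k ks is the stored word of the dual of k ∷ ks.
  insert-dual : ∀ k ks → Admissible (k ∷ ks) → ∀ H F →
    (∀ k ks → Admissible (k ∷ ks) → H (k ∷ ks) ≈ᴹ F (x ∷ core k ks)) →
    ∀ m → Σ (λ e → H ((k ∷ ks) ⊕ e)) (comps (suc (length ks)) m) ≈ᴹ (T_Q · constV F) m (x ∷ core k ks)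
  insert-dual (suc zero) [] (_ , s≤s ()) H F p m
  insert-dual (suc (suc k)) [] _ H F p m = begin
    Σ (λ e → H ((suc (suc k) ∷ []) ⊕ e)) (comps 1 m)
      ≈⟨ Σ-comps _ 0 m ⟩
    conv (λ j n → Σ (λ e → H (suc (suc (k + j)) ∷ [])) (comps 0 n)) m
      ≈⟨ conv-cong (λ j n → ≈ᴹ-trans (Σ-comps-0 _ n)
           (constT-cong (≈ᴹ-trans (p _ [] (s≤s z≤n ∷ [] , s≤s (s≤s z≤n))) (≈ᴹ-reflexive (≡.cong F (eq j)))) n)) m ⟩
    conv (λ j n → constV F n (x ∷ pow y j (pow y k []))) m
      ≈⟨ geom-conv y (X · constV F) m (pow y k []) ⟨
    (G_Y · X · constV F) m (pow y k [])
      ≡⟨ powO-letter y k (G_Y · X · constV F) m [] ⟨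
    (powO Y k · G_Y · X · constV F) m []
      ≡⟨ run-pow idO hQ y k [] (G_Y · X · constV F) m ⟨
    (T_Q · constV F) m (x ∷ core (suc (suc k)) []) ∎
    where
    eq : ∀ j → x ∷ pow y (k + j) [] ≡ x ∷ pow y j (pow y k [])
    eq j = ≡.cong (x ∷_) (≡.trans (≡.cong (λ n → pow y n []) (ℕ.+-comm k j)) (pow-+ y j k []))
  insert-dual (suc k) (k₂ ∷ ks) (s≤s z≤n ∷ ps , l) H F p m = begin
    Σ (λ e → H ((suc k ∷ k₂ ∷ ks) ⊕ e)) (comps (suc (suc (length ks))) m)
      ≈⟨ Σ-comps _ (suc (length ks)) m ⟩
    conv (λ j n → Σ (λ e → H (suc (k + j) ∷ ((k₂ ∷ ks) ⊕ e))) (comps (suc (length ks)) n)) m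
      ≈⟨ conv-cong (λ j n → insert-dual k₂ ks (ps , l) (λ zs → H (suc (k + j) ∷ zs)) (F′ j) (rel j) n) m ⟩
    conv (λ j n → (T_Q · constV (F′ j)) n (x ∷ core k₂ ks)) m
      -- The function given by the induction hypothesis depends on the increment j; `F′` collects
      -- these functions as the coefficients of one power series in λ.
      ≈⟨ ·-conv T_Q F′ m (x ∷ core k₂ ks) ⟨
    (T_Q · F′) m (x ∷ core k₂ ks)
      ≈⟨ ·-cong T_Q F′≈ m (x ∷ core k₂ ks) ⟩
    (T_Q · powO Y k · G_Y · X · constV F) m (x ∷ core k₂ ks)
      ≡⟨ run-pow idO hQ y k (x ∷ core k₂ ks) (G_Y · X · constV F) m ⟨
    (T_Q · constV F) m (x ∷ core (suc k) (k₂ ∷ ks)) ∎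
    where
    F′ : V
    F′ j w = F (x ∷ pow y (k + j) w)
    rel : ∀ j k₃ ks₃ → Admissible (k₃ ∷ ks₃) → H (suc (k + j) ∷ k₃ ∷ ks₃) ≈ᴹ F′ j (x ∷ core k₃ ks₃)
    rel j k₃ ks₃ (q , l) = p (suc (k + j)) (k₃ ∷ ks₃) (s≤s z≤n ∷ q , l)
    F′≈ : F′ ≈ powO Y k · G_Y · X · constV F
    F′≈ j w = begin
      F (x ∷ pow y (k + j) w)
        ≡⟨ ≡.cong (λ v → F (x ∷ v)) (≡.trans (≡.cong (λ n → pow y n w) (ℕ.+-comm k j)) (pow-+ y j k w)) ⟩
      F (x ∷ pow y j (pow y k w))
        ≈⟨ conv-constT (λ j → F (x ∷ pow y j (pow y k w))) j ⟨
      conv (λ i n → (X · constV F) n (pow y i (pow y k w))) j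
        ≈⟨ geom-conv y (X · constV F) j (pow y k w) ⟨
      (G_Y · X · constV F) j (pow y k w)
        ≡⟨ powO-letter y k (G_Y · X · constV F) j w ⟨
      (powO Y k · G_Y · X · constV F) j w ∎

  -- The map Iᵗ as a substitution

  τ-additive : Additive τ
  τ-additive = record { cong = τ-cong ; zer = τ-0 ; add = τ-+ }

  iter : (Carrierᴹ → Carrierᴹ) → ℕ → Carrierᴹ → Carrierᴹ
  iter φ zero    s = s
  iter φ (suc n) s = φ (iter φ n s)

  iter-additive : ∀ {φ} → Additive φ → ∀ n → Additive (iter φ n)
  iter-additive φ zero    = record { cong = λ p → p ; zer = ≈ᴹ-refl ; add = λ _ _ → ≈ᴹ-refl }
  iter-additive φ (suc n) = record
    { cong = λ p → cong φ (cong φⁿ p)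
    ; zer = ≈ᴹ-trans (cong φ (zer φⁿ)) (zer φ)
    ; add = λ s t → ≈ᴹ-trans (cong φ (add φⁿ s t)) (add φ _ _) }
    where φⁿ = iter-additive φ n

  Iᵗ : (Index → Carrierᴹ) → List (ℕ × Index) → Carrierᴹ
  Iᵗ H = Σ (λ pk → iter τ (proj₁ pk) (H (proj₂ pk)))

  It-go-run : ∀ a ks → Positive ks → ∀ u (H : Index → Carrierᴹ) (F : V) m →
    (∀ k zs → Positive zs → H (suc k ∷ zs) ≈ᴹ F m (push zs (pow x k u))) →
    Iᵗ H (It-go (suc a) ks) ≈ᴹ (runI hσ ks · F) m (pow x a u)
  It-go-run a []           _                u H F m p = ≈ᴹ-trans (+ᴹ-identityʳ _) (p a [] [])
  It-go-run a (suc k ∷ ks) (s≤s z≤n ∷ kspos) u H F m p = begin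
    Iᵗ H (It-go (suc a) (suc k ∷ ks))
      ≈⟨ Σ-++ _ (map _ (It-go (suc k) ks)) _ ⟩
    Σ _ (map _ (It-go (suc k) ks)) +ᴹ Σ _ (map _ (It-go (suc a + suc k) ks))
      ≈⟨ +ᴹ-cong (Σ-map _ _ (It-go (suc k) ks)) (Σ-map _ _ (It-go (suc a + suc k) ks)) ⟩
    Iᵗ (λ zs → H (suc a ∷ zs)) (It-go (suc k) ks) +ᴹ Σ (λ pk → τ (iter τ (proj₁ pk) (H (proj₂ pk)))) (It-go (suc a + suc k) ks)
      ≈⟨ +ᴹ-cong ≈ᴹ-refl (Σ-additive τ-additive _ (It-go (suc a + suc k) ks)) ⟨
    Iᵗ (λ zs → H (suc a ∷ zs)) (It-go (suc k) ks) +ᴹ τ (Iᵗ H (It-go (suc a + suc k) ks))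
      ≈⟨ +ᴹ-cong (It-go-run k ks kspos (y ∷ pow x a u) (λ zs → H (suc a ∷ zs)) F m
                   (λ j zs q → p a (suc j ∷ zs) (s≤s z≤n ∷ q)))
                 (τ-cong (It-go-run (a + suc k) ks kspos u H F m p)) ⟩
    (R · F) m (pow x k (y ∷ pow x a u)) +ᴹ τ ((R · F) m (pow x (a + suc k) u))
      ≡⟨ ≡.cong (λ w → (R · F) m (pow x k (y ∷ pow x a u)) +ᴹ τ ((R · F) m w)) eq ⟩
    (R · F) m (pow x k (y ∷ pow x a u)) +ᴹ τ ((R · F) m (pow x k (x ∷ pow x a u)))
      ≡⟨ ≡.cong₂ (λ s t → s +ᴹ τ t) (powO-letter x k (R · F) m _) (powO-letter x k (R · F) m _) ⟨
    (Y+tX · powO X k · R · F) m (pow x a u) ∎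
    where
    R : Op
    R = runI hσ ks
    -- A plus in place of a comma replaces the y between the two parts by x; with its factor t this
    -- is the summand tX of σ.
    eq : pow x (a + suc k) u ≡ pow x k (x ∷ pow x a u)
    eq = ≡.trans (≡.cong (λ n → pow x n u) (ℕ.+-comm a (suc k))) (pow-+ x (suc k) a u)

  constT-Σ : ∀ {a} {A : Set a} (h : A → Carrierᴹ) as m →
    Σ (λ a → constT (h a) m) as ≈ᴹ constT (Σ h as) m
  constT-Σ h as zero    = ≈ᴹ-refl
  constT-Σ h []       (suc m) = ≈ᴹ-refl
  constT-Σ h (a ∷ as) (suc m) = ≈ᴹ-trans (+ᴹ-identityˡ _) (constT-Σ h as (suc m))

  constT-additive : ∀ {φ} → Additive φ → ∀ s m → φ (constT s m) ≈ᴹ constT (φ s) m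
  constT-additive φ s zero    = ≈ᴹ-refl
  constT-additive φ s (suc m) = zer φ

  It-word : ∀ k ks → Positive (k ∷ ks) → ∀ H F → Realises H F → ∀ m →
    constT (Iᵗ H (It (k ∷ ks))) m ≈ᴹ (T_σ · constV F) m (word (k ∷ ks))
  It-word (suc k) ks (s≤s z≤n ∷ kspos) H F p m = begin
    constT (Iᵗ H (It-go (suc k) ks)) m
      ≈⟨ constT-Σ _ (It-go (suc k) ks) m ⟨
    Σ (λ pk → constT (iter τ (proj₁ pk) (H (proj₂ pk))) m) (It-go (suc k) ks)
      ≈⟨ Σ-cong (λ pk → ≈ᴹ-sym (constT-additive (iter-additive τ-additive (proj₁ pk)) (H (proj₂ pk)) m)) (It-go (suc k) ks) ⟩
    Iᵗ (λ zs → constT (H zs) m) (It-go (suc k) ks)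
      ≈⟨ It-go-run k ks kspos [] (λ zs → constT (H zs) m) (constV F) m (λ j zs q → constT-cong (p j zs q) m) ⟩
    (runI hσ ks · constV F) m (pow x k [])
      ≡⟨ powO-letter x k (runI hσ ks · constV F) m [] ⟨
    (powO X k · runI hσ ks · constV F) m []
      ≡⟨ run-word idO hσ (suc k) ks (constV F) m ⟨
    (T_σ · constV F) m (word (suc k ∷ ks)) ∎

  -- The action of polynomials in t

  private
    variable
      φ ψ : Carrierᴹ → Carrierᴹ

  *ₗ-additive : ∀ q → Additive (q *ₗ_)
  *ₗ-additive q = record { cong = *ₗ-cong ≡.refl ; zer = *ₗ-zeroʳ q ; add = *ₗ-distribˡ q }

  +-additive : Additive φ → Additive ψ → Additive (λ s → φ s +ᴹ ψ s)
  +-additive φ ψ = record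
    { cong = λ p → +ᴹ-cong (cong φ p) (cong ψ p)
    ; zer  = ≈ᴹ-trans (+ᴹ-cong (zer φ) (zer ψ)) (+ᴹ-identityˡ 0ᴹ)
    ; add  = λ s t → ≈ᴹ-trans (+ᴹ-cong (add φ s t) (add ψ s t)) (+ᴹ-interchange _ _ _ _) }

  ∘-additive : Additive φ → Additive ψ → Additive (φ ∘′ ψ)
  ∘-additive φ ψ = record
    { cong = λ p → cong φ (cong ψ p)
    ; zer  = ≈ᴹ-trans (cong φ (zer ψ)) (zer φ)
    ; add  = λ s t → ≈ᴹ-trans (cong φ (add ψ s t)) (add φ _ _) }

  act : Poly → Carrierᴹ → Carrierᴹ
  act []      s = 0ᴹ
  act (a ∷ p) s = a *ₗ s +ᴹ τ (act p s)

  act-additive : ∀ p → Additive (act p)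
  act-additive []      = record
    { cong = λ _ → ≈ᴹ-refl ; zer = ≈ᴹ-refl ; add = λ _ _ → ≈ᴹ-sym (+ᴹ-identityˡ 0ᴹ) }
  act-additive (a ∷ p) = +-additive (*ₗ-additive a) (∘-additive τ-additive (act-additive p))

  act-commutes : Additive φ → (∀ s → φ (τ s) ≈ᴹ τ (φ s)) → (∀ q s → φ (q *ₗ s) ≈ᴹ q *ₗ φ s) →
    ∀ p s → φ (act p s) ≈ᴹ act p (φ s)
  act-commutes φ φτ φ* []      s = zer φ
  act-commutes φ φτ φ* (a ∷ p) s = ≈ᴹ-trans (add φ _ _)
    (+ᴹ-cong (φ* a s) (≈ᴹ-trans (φτ _) (τ-cong (act-commutes φ φτ φ* p s))))

  act-*ₗ : ∀ p q s → act p (q *ₗ s) ≈ᴹ q *ₗ act p s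
  act-*ₗ p q s = ≈ᴹ-sym (act-commutes (*ₗ-additive q) (λ s → ≈ᴹ-sym (τ-*ₗ q s)) (*ₗ-comm q) p s)

  act-τ : ∀ p s → act p (τ s) ≈ᴹ τ (act p s)
  act-τ p s = ≈ᴹ-sym (act-commutes τ-additive (λ _ → ≈ᴹ-refl) τ-*ₗ p s)

  act-comm : ∀ p q s → act p (act q s) ≈ᴹ act q (act p s)
  act-comm p q s = act-commutes (act-additive p) (act-τ p) (act-*ₗ p) q s

  act-one : ∀ s → act pone s ≈ᴹ s
  act-one s = ≈ᴹ-trans (+ᴹ-cong (*ₗ-identityˡ s) τ-0) (+ᴹ-identityʳ s)

  act-padd : ∀ p q s → act (padd p q) s ≈ᴹ act p s +ᴹ act q s
  act-padd []      q       s = ≈ᴹ-sym (+ᴹ-identityˡ _)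
  act-padd (a ∷ p) []      s = ≈ᴹ-sym (+ᴹ-identityʳ _)
  act-padd (a ∷ p) (b ∷ q) s = ≈ᴹ-trans
    (+ᴹ-cong (*ₗ-distribʳ s a b) (≈ᴹ-trans (τ-cong (act-padd p q s)) (τ-+ _ _)))
    (+ᴹ-interchange _ _ _ _)

  act-pscale : ∀ a p s → act (pscale a p) s ≈ᴹ a *ₗ act p s
  act-pscale a []      s = ≈ᴹ-sym (*ₗ-zeroʳ a)
  act-pscale a (b ∷ p) s = ≈ᴹ-trans
    (+ᴹ-cong (*ₗ-assoc a b s) (≈ᴹ-trans (τ-cong (act-pscale a p s)) (τ-*ₗ a _)))
    (≈ᴹ-sym (*ₗ-distribˡ a _ _))

  act-0∷ : ∀ p s → act (0ℚ ∷ p) s ≈ᴹ τ (act p s)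
  act-0∷ p s = ≈ᴹ-trans (+ᴹ-cong (*ₗ-zeroˡ s) ≈ᴹ-refl) (+ᴹ-identityˡ _)

  act-pmul : ∀ p q s → act (pmul p q) s ≈ᴹ act p (act q s)
  act-pmul []      q s = ≈ᴹ-refl
  act-pmul (a ∷ p) q s = ≈ᴹ-trans (act-padd (pscale a q) _ s)
    (+ᴹ-cong (act-pscale a q s) (≈ᴹ-trans (act-0∷ (pmul p q) s) (τ-cong (act-pmul p q s))))

  act-tpow : ∀ j s → act (tpow j) s ≈ᴹ iter τ j s
  act-tpow zero    s = act-one s
  act-tpow (suc j) s = ≈ᴹ-trans (act-0∷ (tpow j) s) (τ-cong (act-tpow j s))

  act-ppow : ∀ p n s → act (ppow p n) s ≈ᴹ iter (act p) n s
  act-ppow p zero    s = act-one s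
  act-ppow p (suc n) s = ≈ᴹ-trans (act-pmul p (ppow p n) s) (cong (act-additive p) (act-ppow p n s))

  act-psum : ∀ {a} {A : Set a} (h : A → Poly) as s →
    act (psum (map h as)) s ≈ᴹ Σ (λ a → act (h a) s) as
  act-psum h []       s = ≈ᴹ-refl
  act-psum h (a ∷ as) s = ≈ᴹ-trans (act-padd (h a) _ s) (+ᴹ-cong ≈ᴹ-refl (act-psum h as s))

  -- Opaque, so that unification does not unfold the normalisation of rationals.
  infixr 7 _⋆_
  opaque
    _⋆_ : ℕ → Carrierᴹ → Carrierᴹ
    n ⋆ s = ℕ→ℚ n *ₗ s

    ⋆-*ₗ : ∀ n s → n ⋆ s ≈ᴹ ℕ→ℚ n *ₗ s
    ⋆-*ₗ n s = ≈ᴹ-refl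

    ⋆-+ : ∀ m n s → (m + n) ⋆ s ≈ᴹ m ⋆ s +ᴹ n ⋆ s
    ⋆-+ m n s = ≈ᴹ-trans (*ₗ-cong (ℕ→ℚ-+ m n) ≈ᴹ-refl) (*ₗ-distribʳ s _ _)

    ⋆-additive : ∀ n → Additive (n ⋆_)
    ⋆-additive n = *ₗ-additive (ℕ→ℚ n)

    0-⋆ : ∀ s → 0 ⋆ s ≈ᴹ 0ᴹ
    0-⋆ s = *ₗ-zeroˡ s

    1-⋆ : ∀ s → 1 ⋆ s ≈ᴹ s
    1-⋆ s = *ₗ-identityˡ s

    act-⋆ : ∀ p n s → act p (n ⋆ s) ≈ᴹ n ⋆ act p s
    act-⋆ p n s = act-*ₗ p (ℕ→ℚ n) s

    τ-⋆ : ∀ n s → τ (n ⋆ s) ≈ᴹ n ⋆ τ s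
    τ-⋆ n s = τ-*ₗ (ℕ→ℚ n) s

  ⋆-cong : ∀ n {s t} → s ≈ᴹ t → n ⋆ s ≈ᴹ n ⋆ t
  ⋆-cong n = cong (⋆-additive n)

  ⋆-pascal : ∀ n k s → (suc n C suc k) ⋆ s ≈ᴹ (n C k) ⋆ s +ᴹ (n C suc k) ⋆ s
  ⋆-pascal n k s = ≈ᴹ-trans
    (≈ᴹ-reflexive (≡.cong (_⋆ s) (≡.sym (nCk+nC[k+1]≡[n+1]C[k+1] n k)))) (⋆-+ (n C k) (n C suc k) s)

  ⋆-vanish : ∀ {n k} s → n < k → (n C k) ⋆ s ≈ᴹ 0ᴹ
  ⋆-vanish s n<k = ≈ᴹ-trans (≈ᴹ-reflexive (≡.cong (_⋆ s) (k>n⇒nCk≡0 n<k))) (0-⋆ s)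

  -- The binomial series behind fᵢ

  o : Carrierᴹ → Carrierᴹ
  o = act oneMinusT

  o-additive : Additive o
  o-additive = act-additive oneMinusT

  o+τ : ∀ s → o s +ᴹ τ s ≈ᴹ s
  o+τ s = begin
    (1ℚ *ₗ s +ᴹ τ ((-ℚ 1ℚ) *ₗ s +ᴹ τ 0ᴹ)) +ᴹ τ s
      ≈⟨ +ᴹ-assoc _ _ _ ⟩
    1ℚ *ₗ s +ᴹ (τ ((-ℚ 1ℚ) *ₗ s +ᴹ τ 0ᴹ) +ᴹ τ s)
      ≈⟨ +ᴹ-cong (*ₗ-identityˡ s) (≈ᴹ-trans (≈ᴹ-sym (τ-+ _ _)) (≈ᴹ-trans (τ-cong cancel) τ-0)) ⟩
    s +ᴹ 0ᴹ
      ≈⟨ +ᴹ-identityʳ s ⟩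
    s ∎
    where
    cancel : ((-ℚ 1ℚ) *ₗ s +ᴹ τ 0ᴹ) +ᴹ s ≈ᴹ 0ᴹ
    cancel = begin
      ((-ℚ 1ℚ) *ₗ s +ᴹ τ 0ᴹ) +ᴹ s
        ≈⟨ +ᴹ-cong (≈ᴹ-trans (+ᴹ-cong ≈ᴹ-refl τ-0) (+ᴹ-identityʳ _)) (≈ᴹ-sym (*ₗ-identityˡ s)) ⟩
      (-ℚ 1ℚ) *ₗ s +ᴹ 1ℚ *ₗ s   ≈⟨ *ₗ-distribʳ s _ _ ⟨
      0ℚ *ₗ s                    ≈⟨ *ₗ-zeroˡ s ⟩
      0ᴹ                         ∎

  binom : ℕ → ℕ → ℕ → ℕ → Carrierᴹ → Carrierᴹ
  binom i p j l s = (l C i) ⋆ (p C j) ⋆ iter τ j (iter o (l ∸ i) s)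

  -- fᵢ(k,e) with p in place of k + e - i - 2; as p varies independently of e, both Pascal recursions hold.
  series : ℕ → ℕ → ℕ → Carrierᴹ → Carrierᴹ
  series i p e s = conv (λ j l → binom i p j l s) e

  act-f : ∀ i k e s → act (f i k e) s ≈ᴹ series i ((k + e) ∸ (i + 2)) e s
  act-f i k e s = ≈ᴹ-trans (act-psum summand (upTo (suc e)) s)
    (Σ-applyUpTo e (λ j → j) (λ j → act (summand j) s) (λ j l → binom i p j l s) term)
    where
    p : ℕ
    p = (k + e) ∸ (i + 2)
    monomial summand : ℕ → Poly
    monomial j = pmul (tpow j) (ppow oneMinusT ((e ∸ i) ∸ j))
    summand j = pscale (ℕ→ℚ ((e ∸ j) C i) *ℚ ℕ→ℚ (p C j)) (monomial j)
    term : ∀ j → act (summand j) s ≈ᴹ binom i p j (e ∸ j) s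
    term j = begin
      act (summand j) s
        ≈⟨ act-pscale _ (monomial j) s ⟩
      (ℕ→ℚ ((e ∸ j) C i) *ℚ ℕ→ℚ (p C j)) *ₗ act (monomial j) s
        ≈⟨ *ₗ-assoc _ _ _ ⟩
      ℕ→ℚ ((e ∸ j) C i) *ₗ ℕ→ℚ (p C j) *ₗ act (monomial j) s
        ≈⟨ ≈ᴹ-trans (⋆-*ₗ ((e ∸ j) C i) _) (*ₗ-cong ≡.refl (⋆-*ₗ (p C j) _)) ⟨
      ((e ∸ j) C i) ⋆ (p C j) ⋆ act (monomial j) s
        ≈⟨ ⋆-cong _ (⋆-cong _ (≈ᴹ-trans (act-pmul (tpow j) (ppow oneMinusT ((e ∸ i) ∸ j)) s) (≈ᴹ-trans (act-tpow j _)
             (cong (iter-additive τ-additive j) (≈ᴹ-trans (act-ppow oneMinusT ((e ∸ i) ∸ j) s)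
               (≈ᴹ-reflexive (≡.cong (λ n → iter o n s) eq))))))) ⟩
      binom i p j (e ∸ j) s ∎
      where
      eq : (e ∸ i) ∸ j ≡ (e ∸ j) ∸ i
      eq = ≡.trans (ℕ.∸-+-assoc e i j) (≡.trans (≡.cong (e ∸_) (ℕ.+-comm i j)) (≡.sym (ℕ.∸-+-assoc e j i)))

  series-additive : ∀ i p e → Additive (series i p e)
  series-additive i p e = record
    { cong = λ eq → conv-cong (λ j l → cong (term j l) eq) e
    ; zer  = ≈ᴹ-trans (conv-cong (λ j l → zer (term j l)) e) (conv-0 e)
    ; add  = λ s t → ≈ᴹ-trans (conv-cong (λ j l → add (term j l) s t) e) (conv-+ _ _ e) }
    where
    term : ∀ j l → Additive (binom i p j l)
    term j l = ∘-additive (⋆-additive (l C i)) (∘-additive (⋆-additive (p C j))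
      (∘-additive (iter-additive τ-additive j) (iter-additive o-additive (l ∸ i))))

  τ-⋆⋆ : ∀ m n s → τ (m ⋆ n ⋆ s) ≈ᴹ m ⋆ n ⋆ τ s
  τ-⋆⋆ m n s = ≈ᴹ-trans (τ-⋆ m _) (⋆-cong m (τ-⋆ n _))

  -- Pascal's rule for C(p+1,j); the part with C(p,j-1) is reindexed at the cost of a factor t.
  pascal-p : ∀ i p e s → series i (suc p) (suc e) s ≈ᴹ series i p (suc e) s +ᴹ τ (series i p e s)
  pascal-p i p e s = begin
    binom i p 0 (suc e) s +ᴹ conv (λ j l → binom i (suc p) (suc j) l s) e
      ≈⟨ +ᴹ-cong ≈ᴹ-refl (conv-cong term e) ⟩
    binom i p 0 (suc e) s +ᴹ conv (λ j l → binom i p (suc j) l s +ᴹ τ (binom i p j l s)) e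
      ≈⟨ +ᴹ-cong ≈ᴹ-refl (conv-+ _ _ e) ⟩
    binom i p 0 (suc e) s +ᴹ (conv (λ j l → binom i p (suc j) l s) e +ᴹ conv (λ j l → τ (binom i p j l s)) e)
      ≈⟨ +ᴹ-assoc _ _ _ ⟨
    series i p (suc e) s +ᴹ conv (λ j l → τ (binom i p j l s)) e
      ≈⟨ +ᴹ-cong ≈ᴹ-refl (conv-additive τ-additive _ e) ⟨
    series i p (suc e) s +ᴹ τ (series i p e s) ∎
    where
    term : ∀ j l → binom i (suc p) (suc j) l s ≈ᴹ binom i p (suc j) l s +ᴹ τ (binom i p j l s)
    term j l = begin
      (l C i) ⋆ (suc p C suc j) ⋆ u
        ≈⟨ ⋆-cong _ (≈ᴹ-trans (⋆-pascal p j u) (+ᴹ-comm _ _)) ⟩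
      (l C i) ⋆ ((p C suc j) ⋆ u +ᴹ (p C j) ⋆ u)
        ≈⟨ add (⋆-additive (l C i)) _ _ ⟩
      (l C i) ⋆ (p C suc j) ⋆ u +ᴹ (l C i) ⋆ (p C j) ⋆ u
        ≈⟨ +ᴹ-cong ≈ᴹ-refl (τ-⋆⋆ _ _ _) ⟨
      binom i p (suc j) l s +ᴹ τ (binom i p j l s) ∎
      where
      u : Carrierᴹ
      u = iter τ (suc j) (iter o (l ∸ i) s)

  o-binom : ∀ i p j l s → o (binom i p j l s) ≈ᴹ (l C i) ⋆ (p C j) ⋆ iter τ j (iter o (suc (l ∸ i)) s)
  o-binom i p j l s = ≈ᴹ-trans (act-⋆ oneMinusT _ _)
    (⋆-cong _ (≈ᴹ-trans (act-⋆ oneMinusT _ _) (⋆-cong _ (o-iter j _))))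
    where
    o-iter : ∀ j s → o (iter τ j s) ≈ᴹ iter τ j (o s)
    o-iter zero    s = ≈ᴹ-refl
    o-iter (suc j) s = ≈ᴹ-trans (act-τ oneMinusT _) (τ-cong (o-iter j s))

  -- Pascal's rule for C(l+1,i+1), once the vanishing summand with l = 0 is split off.
  pascal-i : ∀ i p e s → series (suc i) p (suc e) s ≈ᴹ series i p e s +ᴹ o (series (suc i) p e s)
  pascal-i i p e s = begin
    series (suc i) p (suc e) s
      ≈⟨ conv-last (λ j l → binom (suc i) p j l s) e ⟩
    conv (λ j l → binom (suc i) p j (suc l) s) e +ᴹ binom (suc i) p (suc e) 0 s
      ≈⟨ +ᴹ-cong (conv-cong term e) (⋆-vanish {0} {suc i} _ (s≤s z≤n)) ⟩
    conv (λ j l → binom i p j l s +ᴹ o (binom (suc i) p j l s)) e +ᴹ 0ᴹ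
      ≈⟨ +ᴹ-identityʳ _ ⟩
    conv (λ j l → binom i p j l s +ᴹ o (binom (suc i) p j l s)) e
      ≈⟨ conv-+ _ _ e ⟩
    series i p e s +ᴹ conv (λ j l → o (binom (suc i) p j l s)) e
      ≈⟨ +ᴹ-cong ≈ᴹ-refl (conv-additive o-additive _ e) ⟨
    series i p e s +ᴹ o (series (suc i) p e s) ∎
    where
    -- For l > i the exponent of 1-t really drops by one; for l ≤ i it is truncated, but then
    -- C(l,i+1) = 0.
    shift : ∀ j l → (l C suc i) ⋆ (p C j) ⋆ iter τ j (iter o (l ∸ i) s) ≈ᴹ o (binom (suc i) p j l s)
    shift j l with ℕ.<-≤-connex i l
    ... | inj₁ i<l = ≈ᴹ-sym (≈ᴹ-trans (o-binom (suc i) p j l s)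
                       (≈ᴹ-reflexive (≡.cong (λ n → (l C suc i) ⋆ (p C j) ⋆ iter τ j (iter o n s)) (≡.sym (ℕ.+-∸-assoc 1 i<l)))))
    ... | inj₂ l≤i = ≈ᴹ-trans (⋆-vanish _ (s≤s l≤i)) (≈ᴹ-sym (≈ᴹ-trans (cong o-additive (⋆-vanish _ (s≤s l≤i))) (zer o-additive)))
    term : ∀ j l → binom (suc i) p j (suc l) s ≈ᴹ binom i p j l s +ᴹ o (binom (suc i) p j l s)
    term j l = ≈ᴹ-trans (⋆-pascal l i _) (+ᴹ-cong ≈ᴹ-refl (shift j l))

  series-0-suc : ∀ e s → series 0 e (suc e) s ≈ᴹ o (series 0 e e s)
  series-0-suc e s = begin
    series 0 e (suc e) s
      ≈⟨ conv-last (λ j l → binom 0 e j l s) e ⟩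
    conv (λ j l → binom 0 e j (suc l) s) e +ᴹ binom 0 e (suc e) 0 s
      ≈⟨ +ᴹ-cong (conv-cong (λ j l → ≈ᴹ-sym (o-binom 0 e j l s)) e)
           (≈ᴹ-trans (⋆-cong 1 (⋆-vanish _ (ℕ.n<1+n e))) (zer (⋆-additive 1))) ⟩
    conv (λ j l → o (binom 0 e j l s)) e +ᴹ 0ᴹ
      ≈⟨ +ᴹ-identityʳ _ ⟩
    conv (λ j l → o (binom 0 e j l s)) e
      ≈⟨ conv-additive o-additive _ e ⟨
    o (series 0 e e s) ∎

  -- The binomial theorem for (t + (1-t))ᵉ.
  series-0-diagonal : ∀ e s → series 0 e e s ≈ᴹ s
  series-0-diagonal zero    s = ≈ᴹ-trans (1-⋆ _) (1-⋆ s)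
  series-0-diagonal (suc e) s = begin
    series 0 (suc e) (suc e) s                   ≈⟨ pascal-p 0 e e s ⟩
    series 0 e (suc e) s +ᴹ τ (series 0 e e s)   ≈⟨ +ᴹ-cong (series-0-suc e s) ≈ᴹ-refl ⟩
    o (series 0 e e s) +ᴹ τ (series 0 e e s)     ≈⟨ o+τ (series 0 e e s) ⟩
    series 0 e e s                               ≈⟨ series-0-diagonal e s ⟩
    s                                            ∎

  -- The two Pascal rules combine through (1-t) + t = 1, so that on the diagonal t disappears and
  -- the recursion of C(e,i) remains.
  series-diagonal : ∀ i e s → series (suc i) (suc e) (suc e) s ≈ᴹ series i e e s +ᴹ series (suc i) e e s
  series-diagonal i e s = begin
    series (suc i) (suc e) (suc e) s
      ≈⟨ pascal-p (suc i) e e s ⟩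
    series (suc i) e (suc e) s +ᴹ τ (series (suc i) e e s)
      ≈⟨ +ᴹ-cong (pascal-i i e e s) ≈ᴹ-refl ⟩
    (series i e e s +ᴹ o (series (suc i) e e s)) +ᴹ τ (series (suc i) e e s)
      ≈⟨ +ᴹ-assoc _ _ _ ⟩
    series i e e s +ᴹ (o (series (suc i) e e s) +ᴹ τ (series (suc i) e e s))
      ≈⟨ +ᴹ-cong ≈ᴹ-refl (o+τ (series (suc i) e e s)) ⟩
    series i e e s +ᴹ series (suc i) e e s ∎

  -- fᵢ(k,e) for k = q + i + 1
  fᵉ : ℕ → ℕ → ℕ → Carrierᴹ → Carrierᴹ
  fᵉ i q e = series i ((q + e) ∸ 1) e

  applySeries : (ℕ → Carrierᴹ → Carrierᴹ) → V → V
  applySeries p F m w = conv (λ e n → p e (F n (pow x e w))) m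

  -- For generating series the recursion reads p′(z) = p(z) / (1 - tz), here with z = λX.
  applySeries-tX : ∀ {p p′} → (∀ s → p′ 0 s ≈ᴹ p 0 s) → (∀ e s → p′ (suc e) s ≈ᴹ p (suc e) s +ᴹ τ (p′ e s)) →
    ∀ F m w → applySeries p′ F m w ≈ᴹ (G_tX · applySeries p F) m w
  applySeries-tX p₀ p₊ F zero    w = p₀ _
  applySeries-tX {p} {p′} p₀ p₊ F (suc m) w = begin
    p′ 0 (F (suc m) w) +ᴹ conv (λ e n → p′ (suc e) (F n (pow x e (x ∷ w)))) m
      ≈⟨ +ᴹ-cong (p₀ _) (≈ᴹ-trans (conv-cong (λ e n → p₊ e _) m) (conv-+ _ _ m)) ⟩
    p 0 (F (suc m) w) +ᴹ (conv (λ e n → p (suc e) (F n (pow x e (x ∷ w)))) m +ᴹ conv (λ e n → τ (p′ e (F n (pow x e (x ∷ w))))) m)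
      ≈⟨ +ᴹ-assoc _ _ _ ⟨
    applySeries p F (suc m) w +ᴹ conv (λ e n → τ (p′ e (F n (pow x e (x ∷ w))))) m
      ≈⟨ +ᴹ-cong ≈ᴹ-refl (conv-additive τ-additive _ m) ⟨
    applySeries p F (suc m) w +ᴹ τ (applySeries p′ F m (x ∷ w))
      ≈⟨ +ᴹ-cong ≈ᴹ-refl (τ-cong (applySeries-tX {p} {p′} p₀ p₊ F m (x ∷ w))) ⟩
    (G_tX · applySeries p F) (suc m) w ∎

  -- By applySeries-Φ, Φ i q is the operator Σₑ fᵢ(q+i+1,e) (λX)ᵉ = (λX)ⁱ (1 - λX)^(-i-1) (1 - λtX)^(1-q).
  Π : ℕ → Op
  Π zero    = G_X
  Π (suc i) = Π i ∘ lamO ∘ X ∘ G_X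

  Φ : ℕ → ℕ → Op
  Φ i zero    = D ∘ Π i
  Φ i (suc q) = Φ i q ∘ G_tX

  Π⇄X : ∀ i → Π i ⇄ X
  Π⇄X zero    = G_X⇄X
  Π⇄X (suc i) = ∘-⇄ (Π i) (lamO ∘ X ∘ G_X) X (Π⇄X i)
    (∘-⇄ lamO (X ∘ G_X) X (lam-⇄ X) (∘-⇄ X G_X X X⇄X G_X⇄X))

  Φ⇄X : ∀ i q → Φ i q ⇄ X
  Φ⇄X i zero    = ∘-⇄ D (Π i) X D⇄X (Π⇄X i)
  Φ⇄X i (suc q) = ∘-⇄ (Φ i q) G_tX X (Φ⇄X i q) G_tX⇄X

  applySeries-Π : ∀ i F → applySeries (λ e → series i e e) F ≈ Π i · F
  applySeries-Π zero    F m w = ≈ᴹ-trans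
    (conv-cong (λ e n → series-0-diagonal e _) m) (≈ᴹ-sym (geom-conv x F m w))
  applySeries-Π (suc i) F m w = begin
    S (suc i) m w
      ≈⟨ unfold m w ⟩
    (G_X · lamV (X · S i)) m w
      ≈⟨ ·-cong (G_X ∘ lamO ∘ X) (applySeries-Π i F) m w ⟩
    (G_X · lamV (X · Π i · F)) m w
      ≈⟨ ·-cong (G_X ∘ lamO) (Π⇄X i F) m w ⟨
    (G_X · lamV (Π i · X · F)) m w
      ≈⟨ ·-cong G_X (·-lam (Π i) (X · F)) m w ⟨
    (G_X · Π i · lamV (X · F)) m w
      ≈⟨ ⇄-G_X (Π i) (Π⇄X i) (lamV (X · F)) m w ⟨
    (Π i · G_X · lamV (X · F)) m w
      ≈⟨ ·-cong (Π i) (·-lam G_X (X · F)) m w ⟩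
    (Π i · lamV (G_X · X · F)) m w
      ≈⟨ ·-cong (Π i ∘ lamO) (G_X⇄X F) m w ⟩
    (Π (suc i) · F) m w ∎
    where
    S : ℕ → V
    S i = applySeries (λ e → series i e e) F
    -- `series-diagonal` for generating series: S(i+1) = z S(i) + z S(i+1) with z = λX.
    unfold : ∀ m w → S (suc i) m w ≈ᴹ (G_X · lamV (X · S i)) m w
    unfold zero    w = ⋆-vanish {0} {suc i} _ (s≤s z≤n)
    unfold (suc m) w = begin
      series (suc i) 0 0 (F (suc m) w) +ᴹ conv (λ e n → series (suc i) (suc e) (suc e) (F n (pow x e (x ∷ w)))) m
        ≈⟨ +ᴹ-cong (⋆-vanish {0} {suc i} _ (s≤s z≤n)) (≈ᴹ-trans (conv-cong (λ e n → series-diagonal i e (F n (pow x e (x ∷ w)))) m) (conv-+ _ _ m)) ⟩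
      0ᴹ +ᴹ (S i m (x ∷ w) +ᴹ S (suc i) m (x ∷ w))
        ≈⟨ +ᴹ-identityˡ _ ⟩
      S i m (x ∷ w) +ᴹ S (suc i) m (x ∷ w)
        ≈⟨ +ᴹ-cong ≈ᴹ-refl (unfold m (x ∷ w)) ⟩
      (G_X · lamV (X · S i)) (suc m) w ∎

  -- For e = 0 only C(p,0) = 1 occurs, so the truncation of q - 1 at q = 0 does no harm.
  fᵉ-step : ∀ i q F → applySeries (fᵉ i (suc q)) F ≈ G_tX · applySeries (fᵉ i q) F
  fᵉ-step i q F = applySeries-tX {fᵉ i q} {fᵉ i (suc q)} (λ s → ≈ᴹ-refl) step F
    where
    step : ∀ e s → fᵉ i (suc q) (suc e) s ≈ᴹ fᵉ i q (suc e) s +ᴹ τ (fᵉ i (suc q) e s)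
    step e s rewrite ℕ.+-suc q e = pascal-p i (q + e) e s

  applySeries-Φ : ∀ i q F → applySeries (fᵉ i q) F ≈ Φ i q · F
  applySeries-Φ i zero    F m w = begin
    -- The diagonal is the case q = 1; the case q = 0 follows from it by multiplying with `D`, which
    -- undoes `G_tX`.
    applySeries (fᵉ i 0) F m w            ≈⟨ D-G_tX (applySeries (fᵉ i 0) F) m w ⟨
    (D · G_tX · applySeries (fᵉ i 0) F) m w ≈⟨ ·-cong D (fᵉ-step i 0 F) m w ⟨
    (D · applySeries (fᵉ i 1) F) m w      ≈⟨ ·-cong D (applySeries-Π i F) m w ⟩
    (Φ i 0 · F) m w                       ∎
  applySeries-Φ i (suc q) F m w = begin
    applySeries (fᵉ i (suc q)) F m w      ≈⟨ fᵉ-step i q F m w ⟩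
    (G_tX · applySeries (fᵉ i q) F) m w   ≈⟨ ·-cong G_tX (applySeries-Φ i q F) m w ⟩
    (G_tX · Φ i q · F) m w                ≈⟨ ⇄-G_tX (Φ i q) (Φ⇄X i q) F m w ⟨
    (Φ i (suc q) · F) m w                 ∎

  neg-*ₗ : ∀ s → (-ℚ 1ℚ) *ₗ s ≈ᴹ -ᴹ s
  neg-*ₗ s = inverseˡ-unique _ s (begin
    (-ℚ 1ℚ) *ₗ s +ᴹ s            ≈⟨ +ᴹ-cong ≈ᴹ-refl (*ₗ-identityˡ s) ⟨
    (-ℚ 1ℚ) *ₗ s +ᴹ 1ℚ *ₗ s      ≈⟨ *ₗ-distribʳ s _ _ ⟨
    0ℚ *ₗ s                       ≈⟨ *ₗ-zeroˡ s ⟩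
    0ᴹ                            ∎)

  ν : Carrierᴹ → Carrierᴹ
  ν = act minusTOneMinusT

  ν-N : ∀ F m w → ν (F m w) ≈ᴹ (N · F) m w
  ν-N F m w = begin
    0ℚ *ₗ s +ᴹ τ ((-ℚ 1ℚ) *ₗ s +ᴹ τ (act pone s))
      ≈⟨ +ᴹ-cong (*ₗ-zeroˡ s) (τ-cong (+ᴹ-cong (neg-*ₗ s) (τ-cong (act-one s)))) ⟩
    0ᴹ +ᴹ τ ((-ᴹ s) +ᴹ τ s)
      ≈⟨ +ᴹ-identityˡ _ ⟩
    τ ((-ᴹ s) +ᴹ τ s)
      ≈⟨ τ-+ _ _ ⟩
    τ (-ᴹ s) +ᴹ τ (τ s)
      ≈⟨ +ᴹ-cong (·-neg tO F m w) ≈ᴹ-refl ⟩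
    (N · F) m w ∎
    where
    s : Carrierᴹ
    s = F m w

  powO-⇄X : ∀ a → powO X a ⇄ X
  powO-⇄X zero    F = refl {X · F}
  powO-⇄X (suc a) = ∘-⇄ X (powO X a) X X⇄X (powO-⇄X a)

  -- Each substituted letter x brings a factor `G_tX`, which raises q by one. This is how the weight
  -- of a block enters its factor fᵢ.
  Φ-shift : ∀ i q a b F → Φ i q · powO X a · powO (X ∘ G_tX) b · F ≈ Φ i (q + b) · powO X (a + b) · F
  Φ-shift i q a zero    F rewrite ℕ.+-identityʳ q | ℕ.+-identityʳ a = refl {Φ i q · powO X a · F}
  Φ-shift i q a (suc b) F rewrite ℕ.+-suc q b | ℕ.+-suc a b =
    trans (·-cong (Φ i q) (powO-⇄X a (G_tX · R)))
    (trans (·-cong (Φ i q) (⇄-G_tX (X ∘ powO X a) (∘-⇄ X (powO X a) X X⇄X (powO-⇄X a)) R))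
      (Φ-shift i (suc q) (suc a) b F))
    where
    R : V
    R = powO (X ∘ G_tX) b · F

  Ψ : Op
  Ψ = lamO ∘ X ∘ G_X

  Ψ⇄X : Ψ ⇄ X
  Ψ⇄X = ∘-⇄ lamO (X ∘ G_X) X (lam-⇄ X) (∘-⇄ X G_X X X⇄X G_X⇄X)

  Φ-suc : ∀ i q F → Φ (suc i) q · F ≈ Φ i q · Ψ · F
  Φ-suc i zero    F = refl {D · Π i · Ψ · F}
  Φ-suc i (suc q) F = trans (Φ-suc i q (G_tX · F)) (·-cong (Φ i q) (⇄-G_tX Ψ Ψ⇄X F))

  -- Joining the next part to the block: one `X` replaces the separating y, and the remaining `Ψ`
  -- raises i by one.
  Φ-merge : ∀ i q a F → Φ i q · powO X a · N · lamO · X · X · G_X · F ≈ N · Φ (suc i) q · powO X (suc a) · F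
  Φ-merge i q a F =
    trans (sym (N-⇄ (Φ i q ∘ powO X a) (lamO · X · X · G_X · F)))
    (·-cong N (trans (·-cong (Φ i q) (trans (·-cong (powO X a) (sym (Ψ⇄X F))) (sym (Ψ-powO a F)))) (sym (Φ-suc i q _))))
    where
    Ψ-powO : ∀ a F → Ψ · X · powO X a · F ≈ powO X a · Ψ · X · F
    Ψ-powO zero    F = refl {Ψ · X · F}
    Ψ-powO (suc a) F = trans (Ψ⇄X (X · powO X a · F)) (·-cong X (Ψ-powO a F))

  Φ-conv : ∀ i q a R m u →
    conv (λ j n → fᵉ i q j (R n (pow x a (pow x j u)))) m ≈ᴹ (Φ i q · powO X a · R) m u
  Φ-conv i q a R m u = ≈ᴹ-trans
    (conv-cong (λ j n → ≈ᴹ-reflexive (≡.cong (fᵉ i q j) (≡.sym (powO-letter x a R n (pow x j u))))) m)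
    (applySeries-Φ i q (powO X a · R) m u)

  fᵉ-additive : ∀ i q e → Additive (fᵉ i q e)
  fᵉ-additive i q e = series-additive i ((q + e) ∸ 1) e

  act-fᵉ : ∀ i q k e s → k ≡ suc (q + i) → act (f i k e) s ≈ᴹ fᵉ i q e s
  act-fᵉ i q k e s ≡.refl = ≈ᴹ-trans (act-f i (suc (q + i)) e s)
    (≈ᴹ-reflexive (≡.cong (λ p → series i p e s) (≡.trans (≡.cong₂ _∸_ (lemma i q e) (lemma′ i)) (ℕ.[m+n]∸[m+o]≡n∸o (suc i) (q + e) 1))))
    where
    lemma : ∀ i q e → suc (q + i) + e ≡ suc i + (q + e)
    lemma = solve-∀
    lemma′ : ∀ i → i + 2 ≡ suc i + 1
    lemma′ = solve-∀

  -- Both sides are actions of polynomials in t, which commute.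
  iter-fᵉ : ∀ i q e n s → iter ν n (fᵉ i q e s) ≈ᴹ fᵉ i q e (iter ν n s)
  iter-fᵉ i q e n s = ≈ᴹ-trans (cong νⁿ (≈ᴹ-sym (act-fᵉ i q _ e s ≡.refl)))
    (≈ᴹ-trans (iter-act n s) (act-fᵉ i q _ e _ ≡.refl))
    where
    νⁿ : Additive (iter ν n)
    νⁿ = iter-additive (act-additive minusTOneMinusT) n
    p : Poly
    p = f i (suc (q + i)) e
    iter-act : ∀ n s → iter ν n (act p s) ≈ᴹ act p (iter ν n s)
    iter-act zero    s = ≈ᴹ-refl
    iter-act (suc n) s = ≈ᴹ-trans (cong (act-additive minusTOneMinusT) (iter-act n s)) (act-comm minusTOneMinusT p _)

  -- The sum over block decompositions in gₘ

  blockSum : ℕ → ℕ → ℕ → ℕ → (Index → Carrierᴹ) → ℕ → Blocks → Carrierᴹ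
  blockSum r i K δ H m bs = iter ν (r ∸ length bs)
    (Σ (λ e → act (prodF′ i K δ bs e) (H (sums′ K bs ⊕ e))) (comps (length bs) m))

  restSum : ℕ → (Index → Carrierᴹ) → ℕ → Blocks → Carrierᴹ
  restSum r H m bs = iter ν (r ∸ length bs)
    (Σ (λ e → act (prodF false bs e) (H (map sum bs ⊕ e))) (comps (length bs) m))

  restSum-blockSum : ∀ r H m bs → restSum r H m bs ≈ᴹ blockSum r 0 0 0 H m bs
  restSum-blockSum r H m bs = cong (iter-additive (act-additive minusTOneMinusT) (r ∸ length bs))
    (Σ-cong (λ e → ≈ᴹ-reflexive (≡.cong₂ (λ p k → act p (H (k ⊕ e))) (prodF-false bs e) (sums-0 bs))) (comps (length bs) m))

  -- The first block ends with this part. Parts and blocks both decrease by one, so the power of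
  -- -t(1-t) is unchanged and only the factor of the closed block splits off.
  blockSum-singleton : ∀ r i d k δ H m bs →
    blockSum (suc r) i (i + d) δ H m ((suc k ∷ []) ∷ bs) ≈ᴹ
    conv (λ j n → fᵉ i (d + k + δ) j (restSum r (λ zs → H (suc (i + d + k + j) ∷ zs)) n bs)) m
  blockSum-singleton r i d k δ H m bs = begin
    iter ν n₀ (Σ (λ e → act (prodF′ i (i + d) δ b e) (H (sums′ (i + d) b ⊕ e))) (comps (suc (length bs)) m))
      ≈⟨ cong νⁿ (Σ-comps _ (length bs) m) ⟩
    iter ν n₀ (conv (λ j n → Σ (λ e → act (prodF′ i (i + d) δ b (j ∷ e)) (H (sums′ (i + d) b ⊕ (j ∷ e)))) (comps (length bs) n)) m)
      ≈⟨ conv-additive νⁿ _ m ⟩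
    conv (λ j n → iter ν n₀ (Σ (λ e → act (prodF′ i (i + d) δ b (j ∷ e)) (H (sums′ (i + d) b ⊕ (j ∷ e)))) (comps (length bs) n))) m
      ≈⟨ conv-cong (λ j n → cong νⁿ (≈ᴹ-trans (Σ-cong (term j) (comps (length bs) n))
           (≈ᴹ-sym (Σ-additive (fᵉ-additive i q j) _ (comps (length bs) n))))) m ⟩
    conv (λ j n → iter ν n₀ (fᵉ i q j (Σ (λ e → act (prodF false bs e) (H (suc (i + d + k + j) ∷ (map sum bs ⊕ e)))) (comps (length bs) n)))) m
      ≈⟨ conv-cong (λ j n → iter-fᵉ i q j n₀ _) m ⟩
    conv (λ j n → fᵉ i q j (restSum r (λ zs → H (suc (i + d + k + j) ∷ zs)) n bs)) m ∎
    where
    b : Blocks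
    b = (suc k ∷ []) ∷ bs
    q n₀ : ℕ
    q = d + k + δ
    n₀ = r ∸ length bs
    νⁿ : Additive (iter ν n₀)
    νⁿ = iter-additive (act-additive minusTOneMinusT) n₀
    weight : ∀ i d k δ → i + d + (suc k + 0) + δ ≡ suc (d + k + δ + (i + 0))
    weight = solve-∀
    part : ∀ i d k j → i + d + (suc k + 0) + j ≡ suc (i + d + k + j)
    part = solve-∀
    term : ∀ j e → act (prodF′ i (i + d) δ b (j ∷ e)) (H (sums′ (i + d) b ⊕ (j ∷ e))) ≈ᴹ
      fᵉ i q j (act (prodF false bs e) (H (suc (i + d + k + j) ∷ (map sum bs ⊕ e))))
    term j e = ≈ᴹ-trans (act-pmul (f (i + 0) (i + d + (suc k + 0) + δ) j) (prodF false bs e) _)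
      (≈ᴹ-trans (act-fᵉ (i + 0) q _ j _ (weight i d k δ))
      (≈ᴹ-reflexive (≡.cong₂ (λ i′ h → fᵉ i′ q j (act (prodF false bs e) (H (h ∷ (map sum bs ⊕ e)))))
        (ℕ.+-identityʳ i) (part i d k j))))

  -- The part joins the block of the next one. There is one part more but no new block, which gives
  -- one more factor -t(1-t).
  blockSum-merge : ∀ r i d k δ H m b bs bss → length ((b ∷ bs) ∷ bss) ≤ r →
    blockSum (suc r) i (i + d) δ H m ((suc k ∷ b ∷ bs) ∷ bss) ≈ᴹ
    ν (blockSum r (suc i) (suc i + (d + k)) δ H m ((b ∷ bs) ∷ bss))
  blockSum-merge r i d k δ H m b bs bss l = begin
    iter ν (suc r ∸ len) (Σ merged (comps len m))
      ≡⟨ ≡.cong (λ n → iter ν n (Σ merged (comps len m))) (ℕ.+-∸-assoc 1 l) ⟩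
    iter ν (suc (r ∸ len)) (Σ merged (comps len m))
      ≈⟨ cong (iter-additive (act-additive minusTOneMinusT) (suc (r ∸ len))) (Σ-cong term (comps len m)) ⟩
    ν (blockSum r (suc i) (suc i + (d + k)) δ H m ((b ∷ bs) ∷ bss)) ∎
    where
    weight : ∀ i d k s → i + d + (suc k + s) ≡ suc i + (d + k) + s
    weight = solve-∀
    len : ℕ
    len = length ((b ∷ bs) ∷ bss)
    merged : List ℕ → Carrierᴹ
    merged e = act (prodF′ i (i + d) δ ((suc k ∷ b ∷ bs) ∷ bss) e) (H (sums′ (i + d) ((suc k ∷ b ∷ bs) ∷ bss) ⊕ e))
    term : ∀ e → merged e ≈ᴹ act (prodF′ (suc i) (suc i + (d + k)) δ ((b ∷ bs) ∷ bss) e) (H (sums′ (suc i + (d + k)) ((b ∷ bs) ∷ bss) ⊕ e))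
    term []      = ≈ᴹ-refl
    term (e ∷ es) = ≈ᴹ-reflexive (≡.cong₂ (λ i′ K → act (pmul (f i′ (K + δ) e) (prodF false bss es)) (H ((K + e) ∷ (map sum bss ⊕ es))))
      (ℕ.+-suc i (length bs)) (weight i d k (sum (b ∷ bs))))

  -- The first block has so far collected i parts of total i + d, and k + 1 is the next part.
  blocks-run : ∀ ks → Positive ks → ∀ k i d δ u (H : Index → Carrierᴹ) (F : Word → Carrierᴹ) →
    (∀ a zs → Positive zs → H (suc a ∷ zs) ≈ᴹ F (push zs (pow x a u))) → ∀ m →
    Σ (blockSum (suc (length ks)) i (i + d) δ H m) (blocks-go (suc k) ks) ≈ᴹ
    (Φ i (d + k + δ) · powO X (i + d + k) · runI hθ ks · constV F) m u
  blocks-run [] _ k i d δ u H F p m = begin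
    blockSum 1 i (i + d) δ H m ((suc k ∷ []) ∷ []) +ᴹ 0ᴹ
      ≈⟨ +ᴹ-identityʳ _ ⟩
    blockSum 1 i (i + d) δ H m ((suc k ∷ []) ∷ [])
      ≈⟨ blockSum-singleton 0 i d k δ H m [] ⟩
    conv (λ j n → fᵉ i q j (restSum 0 (λ zs → H (suc (i + d + k + j) ∷ zs)) n [])) m
      ≈⟨ conv-cong (λ j n → cong (fᵉ-additive i q j) (≈ᴹ-trans (Σ-comps-0 _ n) (constT-cong (rest j) n))) m ⟩
    conv (λ j n → fᵉ i q j (constV F n (pow x (i + d + k) (pow x j u)))) m
      ≈⟨ Φ-conv i q (i + d + k) (constV F) m u ⟩
    (Φ i q · powO X (i + d + k) · constV F) m u ∎
    where
    q : ℕ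
    q = d + k + δ
    rest : ∀ j → act pone (H (suc (i + d + k + j) ∷ [])) ≈ᴹ F (pow x (i + d + k) (pow x j u))
    rest j = ≈ᴹ-trans (act-one _) (≈ᴹ-trans (p _ [] []) (≈ᴹ-reflexive (≡.cong F (pow-+ x (i + d + k) j u))))
  blocks-run (suc k₂ ∷ ks) (s≤s z≤n ∷ kspos) k i d δ u H F p m = begin
    Σ (blockSum (suc r) i (i + d) δ H m) (blocks-go (suc k) (suc k₂ ∷ ks))
      ≡⟨ ≡.cong (Σ (blockSum (suc r) i (i + d) δ H m)) (blocks-go-∷ (suc k) (suc k₂) ks) ⟩
    Σ (blockSum (suc r) i (i + d) δ H m) (map (consHead (suc k)) L ++ map ((suc k ∷ []) ∷_) L)
      ≈⟨ Σ-++ (blockSum (suc r) i (i + d) δ H m) (map (consHead (suc k)) L) (map ((suc k ∷ []) ∷_) L) ⟩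
    Σ (blockSum (suc r) i (i + d) δ H m) (map (consHead (suc k)) L) +ᴹ Σ (blockSum (suc r) i (i + d) δ H m) (map ((suc k ∷ []) ∷_) L)
      -- Merging with the next part yields the second term of `hθ y`, starting a new block the
      -- first.
      ≈⟨ +ᴹ-cong (≈ᴹ-trans (Σ-map (blockSum (suc r) i (i + d) δ H m) (consHead (suc k)) L) merged)
                 (≈ᴹ-trans (Σ-map (blockSum (suc r) i (i + d) δ H m) ((suc k ∷ []) ∷_) L) separate) ⟩
    (Φ i q · powO X a · N · lamO · X · X · G_X · Z) m u +ᴹ (Φ i q · powO X a · Y · D · G_X · Z) m u
      ≈⟨ +ᴹ-comm _ _ ⟩
    (Φ i q · powO X a · Y · D · G_X · Z) m u +ᴹ (Φ i q · powO X a · N · lamO · X · X · G_X · Z) m u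
      ≈⟨ ·-+ (Φ i q ∘ powO X a) (Y · D · G_X · Z) (N · lamO · X · X · G_X · Z) m u ⟨
    (Φ i q · powO X a · runI hθ (suc k₂ ∷ ks) · constV F) m u ∎
    where
    r q a : ℕ
    r = suc (length ks)
    q = d + k + δ
    a = i + d + k
    L : List Blocks
    L = blocks-go (suc k₂) ks
    R Z S : V
    R = runI hθ ks · constV F
    Z = powO (X ∘ G_tX) k₂ · R
    S = D · G_X · Z

    q-eq : ∀ d k k₂ δ → d + k + k₂ + δ ≡ d + k + δ + k₂
    q-eq = solve-∀
    a-eq : ∀ i d k k₂ → suc i + (d + k) + k₂ ≡ suc (i + d + k) + k₂
    a-eq = solve-∀

    merged : Σ (λ bs → blockSum (suc r) i (i + d) δ H m (consHead (suc k) bs)) L ≈ᴹ (Φ i q · powO X a · N · lamO · X · X · G_X · Z) m u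
    merged = begin
      Σ (λ bs → blockSum (suc r) i (i + d) δ H m (consHead (suc k) bs)) L
        ≈⟨ Σ-cong-All (All.map (λ { (nonempty b bs bss , l) → blockSum-merge r i d k δ H m b bs bss l }) (blocks-go-shape (suc k₂) ks)) ⟩
      Σ (λ bs → ν (blockSum r (suc i) (suc i + (d + k)) δ H m bs)) L
        ≈⟨ Σ-additive (act-additive minusTOneMinusT) _ L ⟨
      ν (Σ (blockSum r (suc i) (suc i + (d + k)) δ H m) L)
        ≈⟨ cong (act-additive minusTOneMinusT) (blocks-run ks kspos k₂ (suc i) (d + k) δ u H F p m) ⟩
      ν ((Φ (suc i) (d + k + k₂ + δ) · powO X (suc i + (d + k) + k₂) · R) m u)
        ≡⟨ ≡.cong₂ (λ q a → ν ((Φ (suc i) q · powO X a · R) m u)) (q-eq d k k₂ δ) (a-eq i d k k₂) ⟩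
      ν ((Φ (suc i) (q + k₂) · powO X (suc a + k₂) · R) m u)
        ≈⟨ ν-N (Φ (suc i) (q + k₂) · powO X (suc a + k₂) · R) m u ⟩
      (N · Φ (suc i) (q + k₂) · powO X (suc a + k₂) · R) m u
        ≈⟨ ·-cong N (Φ-shift (suc i) q (suc a) k₂ R) m u ⟨
      (N · Φ (suc i) q · powO X (suc a) · Z) m u
        ≈⟨ Φ-merge i q a Z m u ⟨
      (Φ i q · powO X a · N · lamO · X · X · G_X · Z) m u ∎

    separate : Σ (λ bs → blockSum (suc r) i (i + d) δ H m ((suc k ∷ []) ∷ bs)) L ≈ᴹ (Φ i q · powO X a · Y · S) m u
    separate = begin
      Σ (λ bs → blockSum (suc r) i (i + d) δ H m ((suc k ∷ []) ∷ bs)) L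
        ≈⟨ Σ-cong (blockSum-singleton r i d k δ H m) L ⟩
      Σ (λ bs → conv (λ j n → fᵉ i q j (restSum r (H′ j) n bs)) m) L
        ≈⟨ Σ-conv (λ bs j n → fᵉ i q j (restSum r (H′ j) n bs)) L m ⟩
      conv (λ j n → Σ (λ bs → fᵉ i q j (restSum r (H′ j) n bs)) L) m
        ≈⟨ conv-cong (λ j n → ≈ᴹ-sym (Σ-additive (fᵉ-additive i q j) (restSum r (H′ j) n) L)) m ⟩
      conv (λ j n → fᵉ i q j (Σ (restSum r (H′ j) n) L)) m
        ≈⟨ conv-cong (λ j n → cong (fᵉ-additive i q j) (rest j n)) m ⟩
      conv (λ j n → fᵉ i q j ((Y · S) n (pow x a (pow x j u)))) m
        ≈⟨ Φ-conv i q a (Y · S) m u ⟩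
      (Φ i q · powO X a · Y · S) m u ∎
      where
      H′ : ℕ → Index → Carrierᴹ
      H′ j zs = H (suc (a + j) ∷ zs)
      rest : ∀ j n → Σ (restSum r (H′ j) n) L ≈ᴹ (Y · S) n (pow x a (pow x j u))
      rest j n = begin
        Σ (restSum r (H′ j) n) L
          ≈⟨ Σ-cong (restSum-blockSum r (H′ j) n) L ⟩
        Σ (blockSum r 0 0 0 (H′ j) n) L
          -- A fresh block: nothing collected yet, and no shift, since only the first block has k′₁
          -- = k₁ + 1.
          ≈⟨ blocks-run ks kspos k₂ 0 0 0 (y ∷ pow x (a + j) u) (H′ j) F
               (λ b zs z → p (a + j) (suc b ∷ zs) (s≤s z≤n ∷ z)) n ⟩
        (Φ 0 (k₂ + 0) · powO X k₂ · R) n (y ∷ pow x (a + j) u)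
          ≡⟨ ≡.cong₂ (λ q w → (Φ 0 q · powO X k₂ · R) n (y ∷ w)) (ℕ.+-identityʳ k₂) (pow-+ x a j u) ⟩
        (Y · Φ 0 k₂ · powO X k₂ · R) n (pow x a (pow x j u))
          -- `Φ 0 0` is `D ∘ G_X`, the factor that `hθ y` puts after `Y`.
          ≈⟨ ·-cong Y (Φ-shift 0 0 0 k₂ R) n (pow x a (pow x j u)) ⟨
        (Y · S) n (pow x a (pow x j u)) ∎

  -- The shift k′₁ = k₁ + 1 contributes one more `G_tX`, which cancels `D`; so the leading y goes to
  -- y (1 - λx)⁻¹.
  g-run : ∀ k ks → Positive (k ∷ ks) → ∀ H F → Realises H F → ∀ m →
    Σ (blockSum (suc (length ks)) 0 0 1 H m) (blocks-go k ks) ≈ᴹ run G_X hθ (word (k ∷ ks)) (constV F) m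
  g-run (suc k) ks (s≤s z≤n ∷ kspos) H F p m = begin
    Σ (blockSum (suc (length ks)) 0 0 1 H m) (blocks-go (suc k) ks)
      ≈⟨ blocks-run ks kspos k 0 0 1 [] H F p m ⟩
    (Φ 0 (k + 1) · powO X k · R) m []
      ≡⟨ ≡.cong (λ q → (Φ 0 q · powO X k · R) m []) (ℕ.+-comm k 1) ⟩
    (Φ 0 (1 + k) · powO X k · R) m []
      ≈⟨ Φ-shift 0 1 0 k R m [] ⟨
    (D · G_X · G_tX · powO (X ∘ G_tX) k · R) m []
      ≈⟨ ·-cong D (⇄-G_tX G_X G_X⇄X _) m [] ⟩
    (D · G_tX · G_X · powO (X ∘ G_tX) k · R) m []
      ≈⟨ D-G_tX (G_X · powO (X ∘ G_tX) k · R) m [] ⟩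
    (G_X · powO (X ∘ G_tX) k · R) m []
      ≡⟨ run-word G_X hθ (suc k) ks (constV F) m ⟨
    run G_X hθ (word (suc k ∷ ks)) (constV F) m ∎
    where
    R : V
    R = runI hθ ks · constV F

-- Coefficient sequences

-- R[[t]], the values of Zᵗ.
Sequences : ∀ {c ℓ} → Module +-*-commutativeRing c ℓ → Module +-*-commutativeRing c ℓ
Sequences R = record
  { Carrierᴹ = ℕ → Carrierᴹ
  ; _≈ᴹ_     = λ s s′ → ∀ n → s n ≈ᴹ s′ n
  ; _+ᴹ_     = λ s s′ n → s n +ᴹ s′ n
  ; _*ₗ_     = λ q s n → q *ₗ s n
  ; _*ᵣ_     = λ s q n → s n *ᵣ q
  ; 0ᴹ       = λ _ → 0ᴹ
  ; -ᴹ_      = λ s n → -ᴹ s n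
  ; isModule = record
    { isBimodule = record
      { isBisemimodule = record
        { +ᴹ-isCommutativeMonoid = Pointwise.isCommutativeMonoid ℕ +ᴹ-isCommutativeMonoid
        ; isPreleftSemimodule = record
          { *ₗ-cong      = λ p q n → *ₗ-cong p (q n)
          ; *ₗ-zeroˡ     = λ s n → *ₗ-zeroˡ (s n)
          ; *ₗ-distribʳ  = λ s p q n → *ₗ-distribʳ (s n) p q
          ; *ₗ-identityˡ = λ s n → *ₗ-identityˡ (s n)
          ; *ₗ-assoc     = λ p q s n → *ₗ-assoc p q (s n)
          ; *ₗ-zeroʳ     = λ p n → *ₗ-zeroʳ p
          ; *ₗ-distribˡ  = λ p s s′ n → *ₗ-distribˡ p (s n) (s′ n) }
        ; isPrerightSemimodule = record
          { *ᵣ-cong      = λ p q n → *ᵣ-cong (p n) q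
          ; *ᵣ-zeroʳ     = λ s n → *ᵣ-zeroʳ (s n)
          ; *ᵣ-distribˡ  = λ s p q n → *ᵣ-distribˡ (s n) p q
          ; *ᵣ-identityʳ = λ s n → *ᵣ-identityʳ (s n)
          ; *ᵣ-assoc     = λ s p q n → *ᵣ-assoc (s n) p q
          ; *ᵣ-zeroˡ     = λ p n → *ᵣ-zeroˡ p
          ; *ᵣ-distribʳ  = λ p s s′ n → *ᵣ-distribʳ p (s n) (s′ n) }
        ; *ₗ-*ᵣ-assoc = λ p s q n → *ₗ-*ᵣ-assoc p (s n) q }
      ; -ᴹ‿cong    = λ p n → -ᴹ‿cong (p n)
      ; -ᴹ‿inverse = (λ s n → -ᴹ‿inverseˡ (s n)) , (λ s n → -ᴹ‿inverseʳ (s n)) }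
    ; *ₗ-*ᵣ-coincident = λ p s n → *ₗ-*ᵣ-coincident p (s n) } }
  where open Module R

-- Application to Z and Zᵗ

module Main {c ℓ : Level} (R : Module +-*-commutativeRing c ℓ) (Z : Index → Module.Carrierᴹ R) where

  private module R = Module R
  open Module (Sequences R)

  -- Multiplication by t on coefficient sequences.
  shift : Carrierᴹ → Carrierᴹ
  shift s zero    = R.0ᴹ
  shift s (suc n) = s n

  shift-cong : ∀ {s s′} → s ≈ᴹ s′ → shift s ≈ᴹ shift s′
  shift-cong p zero    = R.≈ᴹ-refl
  shift-cong p (suc n) = p n

  shift-+ : ∀ s s′ → shift (s +ᴹ s′) ≈ᴹ shift s +ᴹ shift s′
  shift-+ s s′ zero    = R.≈ᴹ-sym (R.+ᴹ-identityˡ R.0ᴹ)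
  shift-+ s s′ (suc n) = R.≈ᴹ-refl

  shift-*ₗ : ∀ q s → shift (q *ₗ s) ≈ᴹ q *ₗ shift s
  shift-*ₗ q s zero    = R.≈ᴹ-sym (R.*ₗ-zeroʳ q)
  shift-*ₗ q s (suc n) = R.≈ᴹ-refl

  shift-linear : LinearEndomorphism (Sequences R)
  shift-linear = record { τ = shift ; τ-cong = shift-cong ; τ-+ = shift-+ ; τ-*ₗ = shift-*ₗ }

  open Operators (Sequences R) shift-linear using (V; _·_; X; ·-cong; _≈_; run; run-cong; G_X; idO; hθ; hQ; T_P; T_Q; T_σ)
  open Sums (Sequences R)
  open Interpolation (Sequences R) shift-linear
  module RSums = Sums R
  open SetoidReasoning ≈ᴹ-setoid

  single : R.Carrierᴹ → Carrierᴹ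
  single = RSums.constT

  coeff-act : ∀ p z n → coeff p n R.*ₗ z R.≈ᴹ act p (single z) n
  coeff-act []      z n       = R.*ₗ-zeroˡ z
  coeff-act (a ∷ p) z zero    = R.≈ᴹ-sym (R.+ᴹ-identityʳ _)
  coeff-act (a ∷ p) z (suc n) = R.≈ᴹ-trans (coeff-act p z n)
    (R.≈ᴹ-trans (R.≈ᴹ-sym (R.+ᴹ-identityˡ _)) (R.+ᴹ-cong (R.≈ᴹ-sym (R.*ₗ-zeroʳ a)) R.≈ᴹ-refl))

  Σ-single : ∀ {a} {A : Set a} (h : A → R.Carrierᴹ) as → Σ (λ a → single (h a)) as ≈ᴹ single (RSums.Σ h as)
  Σ-single h []       zero    = R.≈ᴹ-refl
  Σ-single h []       (suc n) = R.≈ᴹ-refl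
  Σ-single h (a ∷ as) zero    = R.+ᴹ-cong R.≈ᴹ-refl (Σ-single h as zero)
  Σ-single h (a ∷ as) (suc n) = R.≈ᴹ-trans (R.+ᴹ-identityˡ _) (Σ-single h as (suc n))

  Ẑ : Index → Carrierᴹ
  Ẑ k = single (Z k)

  Ẑᵗ : Index → Carrierᴹ
  Ẑᵗ k = Iᵗ Ẑ (It k)

  Zext-Σ : ∀ xs n → Zext R Z xs n R.≈ᴹ Σ (λ pk → act (proj₁ pk) (Ẑ (proj₂ pk))) xs n
  Zext-Σ []             n = R.≈ᴹ-refl
  Zext-Σ ((p , k) ∷ xs) n = R.+ᴹ-cong (coeff-act p (Z k) n) (Zext-Σ xs n)

  Zt-Σ : ∀ xs n → Zt R Z xs n R.≈ᴹ Σ (λ pk → act (proj₁ pk) (Ẑᵗ (proj₂ pk))) xs n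
  Zt-Σ xs n = R.≈ᴹ-trans (Zext-Σ (Itlin R xs) n)
    (≈ᴹ-trans (Σ-concatMap _ _ xs) (Σ-cong term xs) n)
    where
    term : ∀ pk → Σ (λ pk′ → act (proj₁ pk′) (Ẑ (proj₂ pk′)))
        (map (λ jk → pmul (proj₁ pk) (tpow (proj₁ jk)) , proj₂ jk) (It (proj₂ pk)))
      ≈ᴹ act (proj₁ pk) (Ẑᵗ (proj₂ pk))
    term (p , k) = begin
      Σ _ (map (λ jk → pmul p (tpow (proj₁ jk)) , proj₂ jk) (It k))
        ≈⟨ Σ-map _ (λ jk → pmul p (tpow (proj₁ jk)) , proj₂ jk) (It k) ⟩
      Σ (λ jk → act (pmul p (tpow (proj₁ jk))) (Ẑ (proj₂ jk))) (It k)
        ≈⟨ Σ-cong (λ jk → ≈ᴹ-trans (act-pmul p (tpow (proj₁ jk)) _)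
             (cong (act-additive p) (act-tpow (proj₁ jk) _))) (It k) ⟩
      Σ (λ jk → act p (iter shift (proj₁ jk) (Ẑ (proj₂ jk)))) (It k)
        ≈⟨ Σ-additive (act-additive p) _ (It k) ⟨
      act p (Ẑᵗ k) ∎

  onWords : (Index → Carrierᴹ) → V
  onWords H = constV (λ r → H (index r))

  realises : ∀ H → Realises H (λ r → H (index r))
  realises H k ks p = ≈ᴹ-reflexive (≡.cong H (≡.sym (index-push k ks p)))

  -- Stated for arbitrary `H`, since it serves both the Ohno-type relation, with Z, and the
  -- right-hand side of the theorem, with Zᵗ.
  dual-sum : ∀ k ks → Admissible (k ∷ ks) → ∀ H m →
    Σ (λ e → H (dual (dual (k ∷ ks) ⊕ e))) (comps (length (dual (k ∷ ks))) m) ≈ᴹ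
    run idO hQ (word (k ∷ ks)) (onWords H) m
  dual-sum k ks adm H m with dual (k ∷ ks) | dual-∷ k ks adm
  ... | _ | k′ , ks′ , ≡.refl , adm′ , eq = ≈ᴹ-trans
    (insert-dual k′ ks′ adm′ (λ zs → H (dual zs)) (λ r → H (index r))
      (λ k ks p → ≈ᴹ-reflexive (≡.cong H (dual-index k ks p))) m)
    (≈ᴹ-reflexive (≡.cong (λ w → run idO hQ w (onWords H) m) eq))

  Ẑᵗ-T_σ : onWords Ẑᵗ ≈ T_σ · onWords Ẑ
  Ẑᵗ-T_σ m r with index r in eq | unword-∷ r 0 [] | unword-positive r 0 [] []
  ... | _ | k , ks , ≡.refl | p = ≈ᴹ-trans
    (It-word k ks p Ẑ (λ r → Ẑ (index r)) (realises Ẑ) m)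
    (≈ᴹ-reflexive (≡.cong ((T_σ · onWords Ẑ) m) (≡.trans (≡.cong word (≡.sym eq)) (word-index r))))

  -- Words ending in x belong to admissible indices; the `X` in front restricts the equation to
  -- them.
  ohno-words : OhnoType R Z → X · T_Q · onWords Ẑ ≈ X · T_P · onWords Ẑ
  ohno-words ohno m r with index (x ∷ r) in eq | unword-∷ (x ∷ r) 0 [] | index-admissible r
  ... | _ | k , ks , ≡.refl | adm = begin
    run idO hQ (x ∷ r) (onWords Ẑ) m
      ≡⟨ ≡.cong (λ w → run idO hQ w (onWords Ẑ) m) word-eq ⟨
    run idO hQ (word (k ∷ ks)) (onWords Ẑ) m
      ≈⟨ dual-sum k ks adm Ẑ m ⟨
    Σ (λ e → Ẑ (dual (dual (k ∷ ks) ⊕ e))) (comps (length (dual (k ∷ ks))) m)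
      ≈⟨ Σ-single _ (comps (length (dual (k ∷ ks))) m) ⟩
    single (RSums.Σ (λ e → Z (dual (dual (k ∷ ks) ⊕ e))) (comps (length (dual (k ∷ ks))) m))
      ≈⟨ RSums.constT-cong (ohno (k ∷ ks) adm m) ⟨
    single (RSums.Σ (λ e → Z ((k ∷ ks) ⊕ e)) (comps (length (k ∷ ks)) m))
      ≈⟨ Σ-single _ (comps (length (k ∷ ks)) m) ⟨
    Σ (λ e → Ẑ ((k ∷ ks) ⊕ e)) (comps (length (k ∷ ks)) m)
      ≈⟨ insert k ks (proj₁ adm) Ẑ (λ r → Ẑ (index r)) (realises Ẑ) m ⟩
    (T_P · onWords Ẑ) m (word (k ∷ ks))
      ≡⟨ ≡.cong ((T_P · onWords Ẑ) m) word-eq ⟩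
    (T_P · onWords Ẑ) m (x ∷ r) ∎
    where
    word-eq : word (k ∷ ks) ≡ x ∷ r
    word-eq = ≡.trans (≡.cong word (≡.sym eq)) (word-index (x ∷ r))

  g-sum : ∀ k ks → Positive (k ∷ ks) → ∀ m →
    Σ (λ pk → act (proj₁ pk) (Ẑᵗ (proj₂ pk))) (g m (k ∷ ks)) ≈ᴹ run G_X hθ (word (k ∷ ks)) (onWords Ẑᵗ) m
  g-sum k ks p m = begin
    Σ value (g m (k ∷ ks))
      ≡⟨ ≡.cong (Σ value) (g-∷ m k ks) ⟩
    Σ value (concatMap (λ bs → map (entry bs) (comps (length bs) m)) (blocks-go k ks))
      ≈⟨ Σ-concatMap value (λ bs → map (entry bs) (comps (length bs) m)) (blocks-go k ks) ⟩
    Σ (λ bs → Σ value (map (entry bs) (comps (length bs) m))) (blocks-go k ks)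
      ≈⟨ Σ-cong term (blocks-go k ks) ⟩
    Σ (blockSum (suc (length ks)) 0 0 1 Ẑᵗ m) (blocks-go k ks)
      ≈⟨ g-run k ks p Ẑᵗ (λ r → Ẑᵗ (index r)) (realises Ẑᵗ) m ⟩
    run G_X hθ (word (k ∷ ks)) (onWords Ẑᵗ) m ∎
    where
    value : Poly × Index → Carrierᴹ
    value pk = act (proj₁ pk) (Ẑᵗ (proj₂ pk))
    merges : Blocks → ℕ
    merges bs = suc (length ks) ∸ length bs
    entry : Blocks → List ℕ → Poly × Index
    entry bs e = pmul (ppow minusTOneMinusT (merges bs)) (prodF true bs e) , (map sum bs ⊕ e)
    term : ∀ bs → Σ value (map (entry bs) (comps (length bs) m)) ≈ᴹ blockSum (suc (length ks)) 0 0 1 Ẑᵗ m bs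
    term bs = begin
      Σ value (map (entry bs) (comps (length bs) m))
        ≈⟨ Σ-map value (entry bs) (comps (length bs) m) ⟩
      Σ (λ e → value (entry bs e)) (comps (length bs) m)
        ≈⟨ Σ-cong (λ e → ≈ᴹ-trans (act-pmul (ppow minusTOneMinusT (merges bs)) (prodF true bs e) _)
             (≈ᴹ-trans (act-ppow minusTOneMinusT (merges bs) _)
             (≈ᴹ-reflexive (≡.cong₂ (λ p k → iter ν (merges bs) (act p (Ẑᵗ (k ⊕ e)))) (prodF-true bs e) (sums-0 bs)))))
             (comps (length bs) m) ⟩
      Σ (λ e → iter ν (merges bs) (act (prodF′ 0 0 1 bs e) (Ẑᵗ (sums′ 0 bs ⊕ e)))) (comps (length bs) m)
        ≈⟨ Σ-additive (iter-additive (act-additive minusTOneMinusT) (merges bs)) _ (comps (length bs) m) ⟨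
      blockSum (suc (length ks)) 0 0 1 Ẑᵗ m bs ∎

  word-x : ∀ k ks → Admissible (k ∷ ks) → ∃ λ r → word (k ∷ ks) ≡ x ∷ r
  word-x k ks p with flip (core k ks) [] | flip-∷ (core k ks) [] | word-flip k ks p
  ... | _ | r , ≡.refl | eq = r , eq

  theorem : OhnoType R Z → ∀ k → Admissible k → ∀ m →
    Zt R Z (g m k) ≈ᴹ Zt R Z (map (λ e → (pone , dual (dual k ⊕ e))) (comps (length (dual k)) m))
  theorem ohno []       adm zero    n = R.≈ᴹ-refl
  theorem ohno []       adm (suc m) n = R.≈ᴹ-refl
  theorem ohno (k ∷ ks) adm m with word-x k ks adm
  ... | r , eq = begin
    Zt R Z (g m (k ∷ ks))
      ≈⟨ Zt-Σ (g m (k ∷ ks)) ⟩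
    Σ (λ pk → act (proj₁ pk) (Ẑᵗ (proj₂ pk))) (g m (k ∷ ks))
      ≈⟨ g-sum k ks (proj₁ adm) m ⟩
    run G_X hθ (word (k ∷ ks)) (onWords Ẑᵗ) m
      ≈⟨ run-cong G_X hθ (word (k ∷ ks)) Ẑᵗ-T_σ m ⟩
    run G_X hθ (word (k ∷ ks)) (T_σ · onWords Ẑ) m
      ≡⟨ ≡.cong (λ w → run G_X hθ w (T_σ · onWords Ẑ) m) eq ⟩
    run G_X hθ (x ∷ r) (T_σ · onWords Ẑ) m
      ≈⟨ interpolate (onWords Ẑ) (ohno-words ohno) r m ⟩
    run idO hQ (x ∷ r) (T_σ · onWords Ẑ) m
      ≡⟨ ≡.cong (λ w → run idO hQ w (T_σ · onWords Ẑ) m) eq ⟨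
    run idO hQ (word (k ∷ ks)) (T_σ · onWords Ẑ) m
      ≈⟨ run-cong idO hQ (word (k ∷ ks)) Ẑᵗ-T_σ m ⟨
    run idO hQ (word (k ∷ ks)) (onWords Ẑᵗ) m
      ≈⟨ dual-sum k ks adm Ẑᵗ m ⟨
    Σ (λ e → Ẑᵗ (dual (dual (k ∷ ks) ⊕ e))) es
      ≈⟨ Σ-cong (λ e → act-one (Ẑᵗ (dual (dual (k ∷ ks) ⊕ e)))) es ⟨
    Σ (λ e → act pone (Ẑᵗ (dual (dual (k ∷ ks) ⊕ e)))) es
      ≈⟨ Σ-map (λ pk → act (proj₁ pk) (Ẑᵗ (proj₂ pk))) (λ e → pone , dual (dual (k ∷ ks) ⊕ e)) es ⟨
    Σ (λ pk → act (proj₁ pk) (Ẑᵗ (proj₂ pk))) (map (λ e → pone , dual (dual (k ∷ ks) ⊕ e)) es)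
      ≈⟨ Zt-Σ (map (λ e → pone , dual (dual (k ∷ ks) ⊕ e)) es) ⟨
    Zt R Z (map (λ e → pone , dual (dual (k ∷ ks) ⊕ e)) es) ∎
    where
    es : List (List ℕ)
    es = comps (length (dual (k ∷ ks))) m

mainTheorem1 : {c ℓ : Level} (R : Module +-*-commutativeRing c ℓ) (Z : Index → Module.Carrierᴹ R) →
    OhnoType R Z →
    (k : Index) → Admissible k → (m : ℕ) → (n : ℕ) →
    Module._≈ᴹ_ R (Zt R Z (g m k) n)
    (Zt R Z (map (λ e → (pone , dual (dual k ⊕ e))) (comps (length (dual k)) m)) n)
mainTheorem1 R Z ohno k adm m n = Main.theorem R Z ohno k adm m n
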